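{- Let $\mathcal{G}_{n,m}$ and $\mathcal{G}_{n,m}^\perp$ ($n\in\{8,9,10,11,12\}$, $m\ge1$) be the codes described in the context. Then: (i) $\mathcal{G}_{12,1}=[12,6,6]_33$ is a $(3,4)$-PMCF code and, for each $m\ge6$, $\mathcal{G}_{12,m}=[12,6,6]_{3^m}6$ is a $(6,\lambda_{12,m})$-APMCF code for some $\lambda_{12,m}$; $\mathcal{G}_{11,1}=[11,6,5]_32$ is $(2,1)$-PMCF and, for each $m\ge4$, $\mathcal{G}_{11,m}=[11,6,5]_{3^m}5$ is $(5,\lambda_{11,m})$-APMCF for some $\lambda_{11,m}$; $\mathcal{G}_{10,1}=[10,6,4]_32$ is $(2,3)$-PMCF and, for each $m\ge3$, $\mathcal{G}_{10,m}=[10,6,4]_{3^m}4$ is $(4,\lambda_{10,m})$-APMCF for some $\lambda_{10,m}$, with $\lambda_{10,3}=180$; $\mathcal{G}_{9,1}=[9,6,3]_32$ is $(2,9)$-APMCF and, for each $m\ge2$, $\mathcal{G}_{9,m}=[9,6,3]_{3^m}3$ is $(3,\lambda_{9,m})$-APMCF for some $\lambda_{9,m}$, with $\lambda_{9,2}=\lambda_{9,3}=72$; $\mathcal{G}_{8,1}=[8,6,2]_31$ is $(1,2)$-PMCF and, for each $m\ge2$, $\mathcal{G}_{8,m}=[8,6,2]_{3^m}2$ is $(2,\lambda_{8,m})$-APMCF for some $\lambda_{8,m}$, with $\lambda_{8,2}=\lambda_{8,3}=24$. (ii) The following codes are APMCF but not UPWS: $\mathcal{G}_{11,2}=[11,6,5]_94$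 is $(4,30)$-APMCF; $\mathcal{G}_{10,1}^\perp=[10,4,6]_35$ is $(5,36)$-APMCF; $\mathcal{G}_{10,2}^\perp=[10,4,6]_96$ is $(6,180)$-APMCF; $\mathcal{G}_{9,1}^\perp=[9,3,6]_35$ is $(5,18)$-APMCF; $\mathcal{G}_{9,2}^\perp=[9,3,6]_96$ is $(6,72)$-APMCF; $\mathcal{G}_{8,1}^\perp=[8,2,6]_35$ is $(5,8)$-APMCF; $\mathcal{G}_{8,2}^\perp=[8,2,6]_96$ is $(6,24)$-APMCF.
   Context: An $[n,k,d]_qR$ code is a linear $k$-dimensional subspace of $\mathbb{F}_q^n$ with minimum distance $d$ and covering radius $R$. For a linear code $C$ over $\mathbb{F}_q$ with parity check matrix $H$, its $m$-lifted code $C_m$ ($m\ge1$) is $\{x\in\mathbb{F}_{q^m}^n:Hx^T=0\}$ (the $\mathbb{F}_{q^m}$-span of $C$). $B_j(v,C)$ is the number of codewords at Hamming distance $j$ from $v$. Vectors $v$ with $d(v,C)=R$ are farthest-off points. $C$ is an $(R,\lambda)$-APMCF code (almost perfect multiple covering of the farthest-off points) if $B_R(v,C)=\lambda$ for all $v$ with $d(v,C)=R$; if moreover $d\ge2R$, it is $(R,\lambda)$-PMCF. A code with covering radius $R$ is UPWS if there exist rationals $\beta_0,\dots,\beta_R$ with $\sum_{j}\beta_jB_j(v,C)=1$ for all $v$. $\mathcal{G}_{11}$ is the ternary Golay $[11,6,5]_3$ code with generator matrix $[I_6\mid M_{11}]$, $M_{11}=\begin{pmatrix}2&2&2&2&2\\2&2&1&1&0\\2&1&2&0&1\\1&2&0&2&1\\1&0&2&1&2\\0&1&1&2&2\end{pmatrix}$;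 $\mathcal{G}_{12}$ is the extended ternary Golay $[12,6,6]_3$ code with generator matrix $[I_6\mid M_{12}]$, $M_{12}=\begin{pmatrix}0&1&1&1&1&1\\1&0&1&2&2&1\\1&1&0&1&2&2\\1&2&1&0&1&2\\1&2&2&1&0&1\\1&1&2&2&1&0\end{pmatrix}$; $\mathcal{G}_{10},\mathcal{G}_9,\mathcal{G}_8$ are obtained from $\mathcal{G}_{11}$ by deleting coordinates $\{11\}$, $\{10,11\}$, $\{9,10,11\}$. $\mathcal{G}_n^\perp$ is the dual of $\mathcal{G}_n$. $\mathcal{G}_{n,m}$ and $\mathcal{G}_{n,m}^\perp$ are the $m$-lifted codes of $\mathcal{G}_n$ and $\mathcal{G}_n^\perp$ over $\mathbb{F}_{3^m}$, with $\mathcal{G}_{n,1}=\mathcal{G}_n$. -}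

module Defs where

open import Level using (0ℓ)
open import Data.Nat using (ℕ; zero; suc; _^_; _≤_)
open import Data.Fin using (Fin; toℕ)
open import Data.Fin.Properties using (all?)
open import Data.Vec using (Vec; []; _∷_; lookup; take; map)
import Data.Vec.Functional as VF
open import Data.List using (List; []; _∷_; length; filter; concatMap; allFin; foldr)
import Data.List as L
open import Data.List.Relation.Unary.Any using (Any)
open import Data.List.Relation.Unary.All using (All)
open import Data.Product using (Σ; ∃; _×_; _,_)
open import Data.Integer using (+_)
open import Data.Rational using (ℚ; 1ℚ; 0ℚ) renaming (_+_ to _+ℚ_; _*_ to _*ℚ_; _/_ to _/ℚ_)
open import Relation.Binary.PropositionalEquality using (_≡_; _≢_)
open import Relation.Binary.Definitions using (DecidableEquality)
open import Relation.Nullary using (¬_; ¬?)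
open import Algebra.Structures using (IsCommutativeRing)
open import Function.Bundles using (_↔_; Inverse)
import Data.Nat as N

-- A finite field of order 3^m (i.e. a model of F_{3^m}; all such are
-- isomorphic).  Commutative ring with propositional equality, inverses
-- of nonzero elements, and a bijection of the carrier with Fin (3^m).

record GF (m : ℕ) : Set₁ where
  infixl 6 _+_
  infixl 7 _*_
  field
    Carrier : Set
    _+_ _*_ : Carrier → Carrier → Carrier
    -_      : Carrier → Carrier
    0# 1#   : Carrier
    isCommutativeRing : IsCommutativeRing _≡_ _+_ _*_ -_ 0# 1#
    inverse : ∀ x → x ≢ 0# → Σ Carrier (λ y → x * y ≡ 1#)
    enum    : Carrier ↔ Fin (3 ^ m)
    _≟_     : DecidableEquality Carrier

  elements : List Carrier
  elements = L.map (Inverse.from enum) (allFin (3 ^ m))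

  -- the prime field F_3 inside F: entries 0,1,2
  ι : ℕ → Carrier
  ι 0 = 0#
  ι 1 = 1#
  ι 2 = 1# + 1#
  ι _ = 0#

  sumF : List Carrier → Carrier
  sumF = foldr _+_ 0#

  allVecs : (n : ℕ) → List (Fin n → Carrier)
  allVecs zero    = (λ ()) ∷ []
  allVecs (suc n) = concatMap (λ a → L.map (λ v → a VF.∷ v) (allVecs n)) elements

  zeroVec : ∀ {n} → Fin n → Carrier
  zeroVec _ = 0#

  dist : ∀ {n} → (Fin n → Carrier) → (Fin n → Carrier) → ℕ
  dist {n} x y = length (filter (λ j → ¬? (x j ≟ y j)) (allFin n))

  wt : ∀ {n} → (Fin n → Carrier) → ℕ
  wt x = dist x zeroVec

  -- Codes given as the (duplicate-free) list of their codewords.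

  -- m-lifted code of the F_3-code with generator matrix Gm (k × n, entries
  -- in {0,1,2}): the F-span of its rows, listed as the images u·Gm of all
  -- messages u ∈ F^k (injective since Gm is systematic).
  encode : ∀ {k n} → Vec (Vec ℕ n) k → (Fin k → Carrier) → Fin n → Carrier
  encode {k} Gm u j = sumF (L.map (λ i → u i * ι (lookup (lookup Gm i) j)) (allFin k))

  lifted : ∀ {k n} → Vec (Vec ℕ n) k → List (Fin n → Carrier)
  lifted {k} Gm = L.map (encode Gm) (allVecs k)

  -- m-lifted code of the dual: {x ∈ F^n : Gm x^T = 0} (Gm is a parity
  -- check matrix of the dual code)
  syndromeZero? : ∀ {k n} (Gm : Vec (Vec ℕ n) k) (x : Fin n → Carrier) →
                  Relation.Nullary.Dec (∀ i → sumF (L.map (λ j → ι (lookup (lookup Gm i) j) * x j) (allFin n)) ≡ 0#)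
  syndromeZero? {k} {n} Gm x = all? (λ i → sumF (L.map (λ j → ι (lookup (lookup Gm i) j) * x j) (allFin n)) ≟ 0#)

  liftedDual : ∀ {k n} → Vec (Vec ℕ n) k → List (Fin n → Carrier)
  liftedDual {n = n} Gm = filter (syndromeZero? Gm) (allVecs n)

  HasDimension : ∀ {n} → List (Fin n → Carrier) → ℕ → Set
  HasDimension C k = length C ≡ (3 ^ m) ^ k

  -- minimum distance d (of a linear code: minimum nonzero weight)
  HasMinDist : ∀ {n} → List (Fin n → Carrier) → ℕ → Set
  HasMinDist {n} C d =
    Any (λ c → (Σ (Fin n) (λ j → c j ≢ 0#)) × wt c ≡ d) C ×
    All (λ c → Σ (Fin n) (λ j → c j ≢ 0#) → d ≤ wt c) C

  DistToCode : ∀ {n} → (Fin n → Carrier) → List (Fin n → Carrier) → ℕ → Set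
  DistToCode v C r = Any (λ c → dist v c ≡ r) C × All (λ c → r ≤ dist v c) C

  HasCoveringRadius : ∀ {n} → List (Fin n → Carrier) → ℕ → Set
  HasCoveringRadius {n} C R =
    (∀ (v : Fin n → Carrier) → Any (λ c → dist v c ≤ R) C) ×
    Σ (Fin n → Carrier) (λ v → All (λ c → R ≤ dist v c) C)

  IsCode : ∀ {n} → List (Fin n → Carrier) → ℕ → ℕ → ℕ → Set
  IsCode C k d R = HasDimension C k × HasMinDist C d × HasCoveringRadius C R

  B : ∀ {n} → ℕ → (Fin n → Carrier) → List (Fin n → Carrier) → ℕ
  B j v C = length (filter (λ c → dist v c N.≟ j) C)

  APMCF : ∀ {n} → List (Fin n → Carrier) → ℕ → ℕ → Set
  APMCF {n} C R λ' = HasCoveringRadius C R ×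
    (∀ (v : Fin n → Carrier) → DistToCode v C R → B R v C ≡ λ')

  PMCF : ∀ {n} → List (Fin n → Carrier) → ℕ → ℕ → Set
  PMCF C R λ' = APMCF C R λ' × Σ ℕ (λ d → HasMinDist C d × 2 N.* R ≤ d)

  -- UPWS (for a code whose covering radius is R)
  sumℚ : List ℚ → ℚ
  sumℚ = foldr _+ℚ_ 0ℚ

  UPWS : ∀ {n} → List (Fin n → Carrier) → ℕ → Set
  UPWS {n} C R = Σ (Fin (suc R) → ℚ) (λ β → ∀ (v : Fin n → Carrier) →
    sumℚ (L.map (λ j → β j *ℚ ((+ (B (toℕ j) v C)) /ℚ 1)) (allFin (suc R))) ≡ 1ℚ)

-- Generator matrices of the ternary Golay codes

G12 : Vec (Vec ℕ 12) 6
G12 = (1 ∷ 0 ∷ 0 ∷ 0 ∷ 0 ∷ 0 ∷ 0 ∷ 1 ∷ 1 ∷ 1 ∷ 1 ∷ 1 ∷ [])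
    ∷ (0 ∷ 1 ∷ 0 ∷ 0 ∷ 0 ∷ 0 ∷ 1 ∷ 0 ∷ 1 ∷ 2 ∷ 2 ∷ 1 ∷ [])
    ∷ (0 ∷ 0 ∷ 1 ∷ 0 ∷ 0 ∷ 0 ∷ 1 ∷ 1 ∷ 0 ∷ 1 ∷ 2 ∷ 2 ∷ [])
    ∷ (0 ∷ 0 ∷ 0 ∷ 1 ∷ 0 ∷ 0 ∷ 1 ∷ 2 ∷ 1 ∷ 0 ∷ 1 ∷ 2 ∷ [])
    ∷ (0 ∷ 0 ∷ 0 ∷ 0 ∷ 1 ∷ 0 ∷ 1 ∷ 2 ∷ 2 ∷ 1 ∷ 0 ∷ 1 ∷ [])
    ∷ (0 ∷ 0 ∷ 0 ∷ 0 ∷ 0 ∷ 1 ∷ 1 ∷ 1 ∷ 2 ∷ 2 ∷ 1 ∷ 0 ∷ [])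
    ∷ []

G11 : Vec (Vec ℕ 11) 6
G11 = (1 ∷ 0 ∷ 0 ∷ 0 ∷ 0 ∷ 0 ∷ 2 ∷ 2 ∷ 2 ∷ 2 ∷ 2 ∷ [])
    ∷ (0 ∷ 1 ∷ 0 ∷ 0 ∷ 0 ∷ 0 ∷ 2 ∷ 2 ∷ 1 ∷ 1 ∷ 0 ∷ [])
    ∷ (0 ∷ 0 ∷ 1 ∷ 0 ∷ 0 ∷ 0 ∷ 2 ∷ 1 ∷ 2 ∷ 0 ∷ 1 ∷ [])
    ∷ (0 ∷ 0 ∷ 0 ∷ 1 ∷ 0 ∷ 0 ∷ 1 ∷ 2 ∷ 0 ∷ 2 ∷ 1 ∷ [])
    ∷ (0 ∷ 0 ∷ 0 ∷ 0 ∷ 1 ∷ 0 ∷ 1 ∷ 0 ∷ 2 ∷ 1 ∷ 2 ∷ [])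
    ∷ (0 ∷ 0 ∷ 0 ∷ 0 ∷ 0 ∷ 1 ∷ 0 ∷ 1 ∷ 1 ∷ 2 ∷ 2 ∷ [])
    ∷ []

G10 : Vec (Vec ℕ 10) 6
G10 = map (take 10) G11

G9 : Vec (Vec ℕ 9) 6
G9 = map (take 9) G11

G8 : Vec (Vec ℕ 8) 6
G8 = map (take 8) G11

module _ {m : ℕ} (F : GF m) where
  open GF F
  𝒢 : ∀ {n} → Vec (Vec ℕ n) 6 → List (Fin n → Carrier)
  𝒢 Gm = lifted Gm
  𝒢⊥ : ∀ {n} → Vec (Vec ℕ n) 6 → List (Fin n → Carrier)
  𝒢⊥ Gm = liftedDual Gm

{-# OPTIONS --safe #-}
module Submission where

-- A code with check matrix H consists of the x with H x = 0, and the number of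
-- codewords at distance j from v is the number of vectors of weight j with
-- syndrome s = H v. A column c of H with entries in 𝔽₃ can be eliminated: solutions
-- that use the coordinate of c correspond to solutions of the system contracted by
-- c. Hence the distance d of v from the code is the least size of an independent set
-- of columns whose span contains s, and the codewords at distance d correspond to
-- these sets. In coordinates with respect to 𝔽₃-independent field elements, s
-- becomes a finite list of vectors over 𝔽₃, and s lies in the span of a set of columns
-- exactly if the list lies in their 𝔽₃-span. So only finitely many cases remain. If
-- the covering radius is the redundancy, no cases are needed: the sets are then
-- all the bases among the columns, and λ counts them. A code is not UPWS because
-- three of its cosets have contradictory weight distributions.

open import Defs
open import Algebra.Bundles using (CommutativeRing)
import Algebra.Properties.CommutativeMonoid.Sum as Sum
import Algebra.Properties.CommutativeSemigroup as CommutativeSemigroupProperties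
import Algebra.Properties.Ring as RingProperties
import Algebra.Properties.Semiring.Mult as Mult
open import Data.Bool using (Bool; true; false; if_then_else_; _∧_; _∨_; T)
open import Data.Empty using (⊥)
open import Data.Fin using (Fin; zero; suc; toℕ; inject₁; fromℕ)
open import Data.Fin.Permutation using (Permutation; permutation; _⟨$⟩ʳ_)
import Data.Fin.Properties as Finₚ
import Data.Integer as ℤ
open import Data.List as List using (List; []; _∷_; _++_; length; filter)
open import Data.List.Membership.Propositional using (_∈_; _∉_)
open import Data.List.Membership.Propositional.Properties
open import Data.List.Properties using (length-++; length-map; map-tabulate; map-++; map-∘; length-tabulate; filter-accept; filter-some; filter-none; map-cong)
open import Data.List.Relation.Unary.All as All using (All; []; _∷_)
open import Data.List.Relation.Unary.All.Properties using (¬Any⇒All¬)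
open import Data.List.Relation.Unary.AllPairs using ([]; _∷_)
open import Data.List.Relation.Unary.Any as Any using (Any; here; there)
open import Data.List.Relation.Unary.Any.Properties using (lookup-index)
open import Data.List.Relation.Unary.Unique.Propositional using (Unique)
import Data.List.Relation.Unary.Unique.Propositional.Properties as Unique
open import Data.Nat as ℕ using (ℕ; zero; suc; _^_; _∸_; _≤_; _<_; z≤n; s≤s)
import Data.Nat.Properties as ℕₚ
open import Data.Product using (Σ; ∃; _×_; _,_; proj₁; proj₂)
open import Data.Rational as ℚ using (ℚ; 0ℚ; 1ℚ)
import Data.Rational.Properties as ℚₚ
open import Data.Rational.Solver using (module +-*-Solver)
open import Data.Sum using (_⊎_; inj₁; inj₂)
open import Data.Unit using (⊤; tt)
open import Data.Vec as Vec using (Vec; []; _∷_; lookup; map; zipWith; replicate; tabulate; head; tail)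
import Data.Vec.Functional as VF
import Data.Vec.Properties as Vecₚ
open import Function using (_∘_; id)
open import Function.Bundles using (Inverse)
open import Relation.Binary.PropositionalEquality
open import Relation.Nullary using (¬_; Dec; yes; no; does; contradiction; ¬?; _×-dec_)
open import Relation.Unary using (Decidable)
open +-*-Solver using (solve; _:*_; _:+_; _:=_; con)

-- The field is abstract and m is unbounded, so neither its elements nor the words of a code can be
-- enumerated: every check by `refl` has to run over 𝔽₃. This is possible because lifting keeps the
-- ternary check matrix. Only the entries of errors and syndromes are field elements, and
-- elimination by a ternary column merely adds and negates them; beyond matching the definitions,
-- multiplication serves only to derive 3 = 0. So the linear algebra is written once for any
-- `Additive` and used with three kinds of entries: 𝔽₃ for contracting columns, 𝔽₃^t for evaluating
-- tests, and the field itself for the meaning of these tests. A homomorphism between two of them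
-- carries results across. It also follows that a ternary matrix of t columns which certifies a far
-- syndrome does so over every field with m ≥ t, which is how finitely many witnesses settle all
-- large m.

data F₃ : Set where
  0₃ 1₃ 2₃ : F₃

neg : F₃ → F₃
neg 0₃ = 0₃
neg 1₃ = 2₃
neg 2₃ = 1₃

add : F₃ → F₃ → F₃
add 0₃ v = v
add u 0₃ = u
add 1₃ 1₃ = 2₃
add 1₃ 2₃ = 0₃
add 2₃ 1₃ = 0₃
add 2₃ 2₃ = 1₃

-- Finite computations with columns over 𝔽₃

record Additive (A : Set) : Set where
  field
    plus   : A → A → A
    negate : A → A
    nil    : A

  -- Multiplication by 2 is negation: only groups of exponent 3 are meant.
  act : F₃ → A → A
  act 0₃ x = nil
  act 1₃ x = x
  act 2₃ x = negate x

  scale : ∀ {r} → A → Vec F₃ r → Vec A r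
  scale x = map (λ u → act u x)

  zeros : ∀ {r} → Vec A r
  zeros = replicate _ nil

  comb : ∀ {r n} → Vec (Vec F₃ r) n → Vec A n → Vec A r
  comb []         []       = zeros
  comb (c ∷ cols) (x ∷ xs) = zipWith plus (scale x c) (comb cols xs)

  -- For c ≠ 0, a linear map whose kernel is spanned by c.
  eliminate : ∀ {r} → Vec F₃ (suc r) → Vec A (suc r) → Vec A r
  eliminate {zero}  _        _        = []
  eliminate {suc r} (0₃ ∷ c) (x ∷ xs) = x ∷ eliminate c xs
  eliminate {suc r} (1₃ ∷ c) (x ∷ xs) = zipWith (λ u y → plus y (act (neg u) x)) c xs
  eliminate {suc r} (2₃ ∷ c) (x ∷ xs) = zipWith (λ u y → plus y (act u x)) c xs

additive-F₃ : Additive F₃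
additive-F₃ = record { plus = add ; negate = neg ; nil = 0₃ }

additive-Vec : ∀ t → Additive (Vec F₃ t)
additive-Vec t = record { plus = zipWith add ; negate = map neg ; nil = replicate t 0₃ }

isZero : ∀ {r} → Vec F₃ r → Bool
isZero []       = true
isZero (0₃ ∷ c) = isZero c
isZero (_ ∷ c)  = false

contract : ∀ {r n} → Vec F₃ (suc r) → Vec (Vec F₃ (suc r)) n → Vec (Vec F₃ r) n
contract c = map (Additive.eliminate additive-F₃ c)

-- Contractions do not depend on the syndrome, so they are carried out once. A node `take c t u`
-- holds a column already contracted by those chosen above it, with t for the sets that contain it
-- and u for those that do not.
data Trie : ℕ → Set where
  leaf : ∀ {r} → Trie r
  none : ∀ {r} → Trie r
  take : ∀ {r} → Vec F₃ (suc r) → Trie r → Trie (suc r) → Trie (suc r)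

-- The branches are the independent j-subsets of the columns.
trie : ∀ {r n} → Vec (Vec F₃ r) n → ℕ → Trie r
trie         cols       zero    = leaf
trie         []         (suc j) = none
trie {zero}  (_ ∷ _)    (suc j) = none
trie {suc r} (c ∷ cols) (suc j) =
  if isZero c then trie cols (suc j) else take c (trie (contract c cols) j) (trie cols (suc j))

module _ {A : Set} (add-A : Additive A) (zero? : A → Bool) where

  allZero : ∀ {r} → Vec A r → Bool
  allZero []       = true
  allZero (x ∷ xs) = zero? x ∧ allZero xs

  -- The number of branches whose columns span a space containing s.
  count : ∀ {r} → Trie r → Vec A r → ℕ
  count leaf         s = if allZero s then 1 else 0
  count none         s = 0
  count (take c t u) s = count t (Additive.eliminate add-A c s) ℕ.+ count u s

  -- Tests whether `count` is nonzero; the lazy `∨` stops at the first branch that succeeds.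
  hits : ∀ {r} → Trie r → Vec A r → Bool
  hits leaf         s = allZero s
  hits none         s = false
  hits (take c t u) s = hits t (Additive.eliminate add-A c s) ∨ hits u s

allF₃ : ∀ t → List (Vec F₃ t)
allF₃ zero    = [] ∷ []
allF₃ (suc t) = List.cartesianProductWith _∷_ (0₃ ∷ 1₃ ∷ 2₃ ∷ []) (allF₃ t)

Coords : ℕ → Set
Coords r = ∃ λ t → Vec (Vec F₃ t) r

-- A further entry of the syndrome either lies in the span of the basis chosen so far, with
-- arbitrary coordinates, or joins the basis in front. The second is possible only while the basis
-- has fewer than m elements.
extensions : ∀ {r} → ℕ → Coords r → List (Coords (suc r))
extensions m (t , S) =
  List.map (λ a → t , a ∷ S) (allF₃ t) ++
  (if t ℕ.<ᵇ m then (suc t , (1₃ ∷ replicate _ 0₃) ∷ map (0₃ ∷_) S) ∷ [] else [])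

normalForms : ∀ m r → List (Coords r)
normalForms m zero    = (0 , []) ∷ []
normalForms m (suc r) = List.concatMap (extensions m) (normalForms m r)

all? : ∀ {A : Set} → (A → Bool) → List A → Bool
all? p []       = true
all? p (x ∷ xs) = p x ∧ all? p xs

covers : ∀ {r} → Trie r → Trie r → ℕ → Coords r → Bool
covers near far l (t , S) =
  hits (additive-Vec t) isZero near S ∨ (count (additive-Vec t) isZero far S ℕ.≡ᵇ l)

-- `go` takes the tries as arguments so that they can be shared by all normal forms.
coversAll : ∀ {r n} → Vec (Vec F₃ r) n → ℕ → ℕ → ℕ → Bool
coversAll {r} cols m R l = go (trie cols R) (trie cols (suc R))
  where go : Trie r → Trie r → Bool
        go near far = all? (covers near far l) (normalForms m r)

-- Mirrors `ι`, including its default 0 for numbers above 2.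
residue : ℕ → F₃
residue 1 = 1₃
residue 2 = 2₃
residue _ = 0₃

rows : ∀ {k n} → Vec (Vec ℕ n) k → Vec (Vec F₃ n) k
rows = map (map residue)

columns : ∀ {k n} → Vec (Vec ℕ n) k → Vec (Vec F₃ k) n
columns G = tabulate λ j → map (λ g → lookup g j) (rows G)

unit : ∀ {r} → Vec (Vec F₃ r) r
unit {zero}  = []
unit {suc r} = (1₃ ∷ replicate r 0₃) ∷ map (0₃ ∷_) unit

-- For a generator matrix [I | M] this is the check matrix [-Mᵀ | I]; listed by columns it consists
-- of the negated rows of M and the unit vectors.
parity : ∀ {r} → Vec (Vec ℕ (6 ℕ.+ r)) 6 → Vec (Vec F₃ r) (6 ℕ.+ r)
parity G = map (λ g → map neg (Vec.drop 6 g)) (rows G) Vec.++ unit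

-- The deletion and contraction recursion for the number of bases in the matroid of the columns; it
-- yields 0 if they do not span.
bases : ∀ {r n} → Vec (Vec F₃ r) n → ℕ
bases {zero}  cols       = 1
bases {suc r} []         = 0
bases {suc r} (c ∷ cols) = if isZero c then bases cols else bases (contract c cols) ℕ.+ bases cols

-- Every set of at most d columns is independent.
separated : ∀ {r n} → Vec (Vec F₃ r) n → ℕ → Bool
separated         cols       zero    = true
separated         []         (suc d) = true
separated {zero}  (_ ∷ _)    (suc d) = false
separated {suc r} (c ∷ cols) (suc d) =
  if isZero c then false else separated (contract c cols) d ∧ separated cols (suc d)

-- Counts the columns that depend on earlier ones: contraction by the independent columns before
-- them has made them zero.
nullity : ∀ {r n} → Vec (Vec F₃ r) n → ℕ
nullity         []         = 0
nullity {zero}  (_ ∷ cols) = suc (nullity cols)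
nullity {suc r} (c ∷ cols) = if isZero c then suc (nullity cols) else nullity (contract c cols)

-- The number of solutions of weight j over a field of order q. The truncated
-- subtraction is exact: the solutions for cols are among the contracted ones.
exact : ∀ {r n t} → ℕ → Vec (Vec F₃ r) n → Vec (Vec F₃ t) r → ℕ → ℕ
exact {t = t} q cols       S zero    = if allZero (additive-Vec t) isZero S then 1 else 0
exact         q []         S (suc j) = 0
exact {zero}  q (_ ∷ cols) S (suc j) = exact q cols S (suc j) ℕ.+ (q ℕ.∸ 1) ℕ.* exact q cols S j
exact {suc r} {t = t} q (c ∷ cols) S (suc j) = exact q cols S (suc j) ℕ.+
  (if isZero c then (q ℕ.∸ 1) ℕ.* exact q cols S j
   else exact q (contract c cols) (Additive.eliminate (additive-Vec t) c S) j ℕ.∸ exact q cols S j)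

-- All sizes below R are tested, because `solutions-minimal` speaks about a weight only after the
-- smaller weights are excluded.
farther : ∀ {r n t} → Vec (Vec F₃ r) n → Vec (Vec F₃ t) r → ℕ → Bool
farther         cols S zero    = true
farther {t = t} cols S (suc R) =
  (count (additive-Vec t) isZero (trie cols R) S ℕ.≡ᵇ 0) ∧ farther cols S R

weight₃ : ∀ {n} → Vec F₃ n → ℕ
weight₃ []       = 0
weight₃ (0₃ ∷ x) = weight₃ x
weight₃ (_ ∷ x)  = suc (weight₃ x)

-- Counting with duplicate-free lists

lookup-injective : ∀ {A : Set} {xs : List A} → Unique xs → ∀ i j → List.lookup xs i ≡ List.lookup xs j → i ≡ j
lookup-injective (_   ∷ _) zero    zero    _  = refl
lookup-injective (x∉  ∷ _) zero    (suc j) eq = contradiction eq (All.lookup x∉ (∈-lookup j))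
lookup-injective (x∉  ∷ _) (suc i) zero    eq = contradiction (sym eq) (All.lookup x∉ (∈-lookup i))
lookup-injective (_   ∷ u) (suc i) (suc j) eq = cong suc (lookup-injective u i j eq)

injection⇒length≤ : ∀ {A B : Set} {xs : List A} {ys : List B} → Unique xs → (f : A → B) →
  (∀ {x} → x ∈ xs → f x ∈ ys) → (∀ {x y} → x ∈ xs → y ∈ xs → f x ≡ f y → x ≡ y) →
  length xs ≤ length ys
injection⇒length≤ {xs = xs} {ys} unique f into injective = Finₚ.injective⇒≤ {f = position} λ {i} {j} eq →
  lookup-injective unique i j (injective (∈-lookup i) (∈-lookup j) (begin
    f (List.lookup xs i)           ≡⟨ lookup-index (into (∈-lookup i)) ⟩
    List.lookup ys (position i)    ≡⟨ cong (List.lookup ys) eq ⟩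
    List.lookup ys (position j)    ≡⟨ lookup-index (into (∈-lookup j)) ⟨
    f (List.lookup xs j)           ∎))
  where
  open ≡-Reasoning
  position : Fin (length xs) → Fin (length ys)
  position i = Any.index (into (∈-lookup i))

record Listing {A : Set} (P : A → Set) (xs : List A) : Set where
  field
    unique   : Unique xs
    sound    : ∀ {x} → x ∈ xs → P x
    complete : ∀ {x} → P x → x ∈ xs

open Listing

none⇒length≡0 : ∀ {A : Set} {P : A → Set} {xs} → Listing P xs → (∀ {x} → ¬ P x) → length xs ≡ 0
none⇒length≡0 {xs = []}    L ¬P = refl
none⇒length≡0 {xs = _ ∷ _} L ¬P = contradiction (sound L (here refl)) ¬P

filter-listing : ∀ {A : Set} {P Q : A → Set} {xs} (Q? : Decidable Q) → Listing P xs →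
  Listing (λ x → P x × Q x) (filter Q? xs)
filter-listing {xs = xs} Q? L = record
  { unique   = Unique.filter⁺ Q? (unique L)
  ; sound    = λ x∈ → sound L (proj₁ (∈-filter⁻ Q? {xs = xs} x∈)) , proj₂ (∈-filter⁻ Q? {xs = xs} x∈)
  ; complete = λ (p , q) → ∈-filter⁺ Q? (complete L p) q
  }

bijection⇒length≡ : ∀ {A B : Set} {P : A → Set} {Q : B → Set} {xs ys} → Listing P xs → Listing Q ys →
  (f : A → B) (g : B → A) → (∀ {x} → P x → Q (f x)) → (∀ {y} → Q y → P (g y)) →
  (∀ {x} → P x → g (f x) ≡ x) → (∀ {y} → Q y → f (g y) ≡ y) → length xs ≡ length ys
bijection⇒length≡ L M f g f-into g-into g∘f f∘g = ℕₚ.≤-antisym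
  (injection⇒length≤ (unique L) f (complete M ∘ f-into ∘ sound L)
    λ x∈ y∈ eq → trans (sym (g∘f (sound L x∈))) (trans (cong g eq) (g∘f (sound L y∈))))
  (injection⇒length≤ (unique M) g (complete L ∘ g-into ∘ sound M)
    λ x∈ y∈ eq → trans (sym (f∘g (sound M x∈))) (trans (cong f eq) (f∘g (sound M y∈))))

module _ {A : Set} {P Q : A → Set} (P? : Decidable P) (Q? : Decidable Q) where

  length-filter-split : ∀ xs → length (filter P? xs) ≡
    length (filter (λ x → P? x ×-dec Q? x) xs) ℕ.+ length (filter (λ x → P? x ×-dec ¬? (Q? x)) xs)
  length-filter-split [] = refl
  length-filter-split (x ∷ xs) with does (P? x) | does (Q? x)
  ... | false | _     = length-filter-split xs
  ... | true  | true  = cong suc (length-filter-split xs)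
  ... | true  | false = trans (cong suc (length-filter-split xs)) (sym (ℕₚ.+-suc _ _))

length-cartesianProductWith : ∀ {A B C : Set} (f : A → B → C) xs ys →
  length (List.cartesianProductWith f xs ys) ≡ length xs ℕ.* length ys
length-cartesianProductWith f []       ys = refl
length-cartesianProductWith f (x ∷ xs) ys = trans (length-++ (List.map (f x) ys))
  (cong₂ ℕ._+_ (length-map (f x) ys) (length-cartesianProductWith f xs ys))

-- A missing y could be put in front of xs, and this longer list would still inject into ys.
unique⇒surjective : ∀ {A : Set} → (∀ x y → Dec (x ≡ y)) → {xs ys : List A} → Unique xs →
  (∀ {x} → x ∈ xs → x ∈ ys) → length ys ≤ length xs → ∀ {y} → y ∈ ys → y ∈ xs
unique⇒surjective _≟_ {xs} {ys} unique into longer {y} y∈ with Any.any? (y ≟_) xs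
... | yes y∈xs = y∈xs
... | no  y∉xs = contradiction (ℕₚ.≤-trans (injection⇒length≤ unique′ id into′ λ _ _ → id) longer) (ℕₚ.n≮n _)
  where
  unique′ : Unique (y ∷ xs)
  unique′ = All.tabulate (λ x∈ eq → y∉xs (subst (_∈ xs) (sym eq) x∈)) ∷ unique
  into′ : ∀ {x} → x ∈ y ∷ xs → x ∈ ys
  into′ (here refl) = y∈
  into′ (there x∈)  = into x∈

-- Maps that commute with 𝔽₃-combinations

isZero-true : ∀ {r} (c : Vec F₃ r) → isZero c ≡ true → c ≡ replicate r 0₃
isZero-true []       _  = refl
isZero-true (0₃ ∷ c) eq = cong (0₃ ∷_) (isZero-true c eq)

isZero-zeros : ∀ r → isZero (replicate r 0₃) ≡ true
isZero-zeros zero    = refl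
isZero-zeros (suc r) = isZero-zeros r

-- Elimination and combination are built from addition, negation and zero alone, so they commute
-- with every homomorphism. Two kinds occur: `evaluation`, from 𝔽₃ to the multiples of a field
-- element, and `dot-hom`, from coordinates to the field.
record Hom {A B : Set} (add-A : Additive A) (add-B : Additive B) (h : A → B) : Set where
  open Additive

  field
    plus-homo   : ∀ x y → h (plus add-A x y) ≡ plus add-B (h x) (h y)
    negate-homo : ∀ x → h (negate add-A x) ≡ negate add-B (h x)
    nil-homo    : h (nil add-A) ≡ nil add-B

  act-homo : ∀ u x → h (act add-A u x) ≡ act add-B u (h x)
  act-homo 0₃ x = nil-homo
  act-homo 1₃ x = refl
  act-homo 2₃ x = negate-homo x

  scale-homo : ∀ {r} x (c : Vec F₃ r) → map h (scale add-A x c) ≡ scale add-B (h x) c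
  scale-homo x []      = refl
  scale-homo x (u ∷ c) = cong₂ _∷_ (act-homo u x) (scale-homo x c)

  zeros-homo : ∀ {r} → map h (zeros add-A {r}) ≡ zeros add-B
  zeros-homo {zero}  = refl
  zeros-homo {suc r} = cong₂ _∷_ nil-homo zeros-homo

  zipWith-plus-homo : ∀ {r} (x y : Vec A r) →
    map h (zipWith (plus add-A) x y) ≡ zipWith (plus add-B) (map h x) (map h y)
  zipWith-plus-homo []      []      = refl
  zipWith-plus-homo (a ∷ x) (b ∷ y) = cong₂ _∷_ (plus-homo a b) (zipWith-plus-homo x y)

  comb-homo : ∀ {r n} (cols : Vec (Vec F₃ r) n) x → map h (comb add-A cols x) ≡ comb add-B cols (map h x)
  comb-homo []         []      = zeros-homo
  comb-homo (c ∷ cols) (a ∷ x) =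
    trans (zipWith-plus-homo _ _) (cong₂ (zipWith (plus add-B)) (scale-homo a c) (comb-homo cols x))

  private
    pivot-homo : ∀ {r} a (f : F₃ → F₃) (c : Vec F₃ r) x →
      map h (zipWith (λ u y → plus add-A y (act add-A (f u) a)) c x) ≡
      zipWith (λ u y → plus add-B y (act add-B (f u) (h a))) c (map h x)
    pivot-homo a f []      []      = refl
    pivot-homo a f (u ∷ c) (b ∷ x) =
      cong₂ _∷_ (trans (plus-homo b _) (cong (plus add-B (h b)) (act-homo (f u) a))) (pivot-homo a f c x)

  eliminate-homo : ∀ {r} (c : Vec F₃ (suc r)) x →
    map h (eliminate add-A c x) ≡ eliminate add-B c (map h x)
  eliminate-homo {zero}  _        _       = refl
  eliminate-homo {suc r} (0₃ ∷ c) (a ∷ x) = cong (h a ∷_) (eliminate-homo c x)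
  eliminate-homo {suc r} (1₃ ∷ c) (a ∷ x) = pivot-homo a neg c x
  eliminate-homo {suc r} (2₃ ∷ c) (a ∷ x) = pivot-homo a id c x

-- Characteristic 3, and elimination over the field

module FieldProperties {m : ℕ} (F : GF m) where

  open GF F

  ring : CommutativeRing _ _
  ring = record { isCommutativeRing = isCommutativeRing }

  open CommutativeRing ring public
    using (+-assoc; +-comm; +-identityˡ; +-identityʳ; -‿inverseˡ; -‿inverseʳ;
           *-comm; *-assoc; *-identityˡ; *-identityʳ; zeroˡ; zeroʳ; distribʳ)
  open RingProperties (CommutativeRing.ring ring) public
    using (-‿involutive; -0#≈0#; -‿+-comm; +-cancelˡ; +-cancelʳ)
  open CommutativeSemigroupProperties (CommutativeRing.+-commutativeSemigroup ring) public
    using () renaming (interchange to +-interchange)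
  open Sum (CommutativeRing.+-commutativeMonoid ring)
    using (sum; sum-permute; sum-cong-≗; ∑-distrib-+; sum-replicate)
  open Mult (CommutativeRing.semiring ring) using (×1-homo-*; ×-homo-1) renaming (_×_ to _×ᵐ_)
  module enum = Inverse enum

  order : ℕ
  order = 3 ^ m

  -- Translation by x permutes the field, so the sum of all elements is
  -- unchanged when x is added to each of them.
  order×x≡0 : ∀ x → order ×ᵐ x ≡ 0#
  order×x≡0 x = +-cancelˡ total _ _ (begin
    total + order ×ᵐ x                            ≡⟨ cong (total +_) (sum-replicate order {x}) ⟨
    total + sum {order} (λ _ → x)                         ≡⟨ ∑-distrib-+ {order} enum.from (λ _ → x) ⟨
    sum {order} (λ i → enum.from i + x)           ≡⟨ sum-cong-≗ {order} (λ i → enum.strictlyInverseʳ (enum.from i + x)) ⟨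
    sum {order} (λ i → enum.from (translation ⟨$⟩ʳ i))    ≡⟨ sum-permute enum.from translation ⟨
    total                                         ≡⟨ +-identityʳ total ⟨
    total + 0#                                    ∎)
    where
    open ≡-Reasoning
    total = sum enum.from
    shift : Carrier → Fin order → Fin order
    shift y i = enum.to (enum.from i + y)
    shift-shift : ∀ y z i → y + z ≡ 0# → shift z (shift y i) ≡ i
    shift-shift y z i y+z≡0 = begin
      enum.to (enum.from (shift y i) + z)  ≡⟨ cong (λ w → enum.to (w + z)) (enum.strictlyInverseʳ _) ⟩
      enum.to (enum.from i + y + z)        ≡⟨ cong enum.to (+-assoc _ y z) ⟩
      enum.to (enum.from i + (y + z))      ≡⟨ cong (λ w → enum.to (enum.from i + w)) y+z≡0 ⟩
      enum.to (enum.from i + 0#)           ≡⟨ cong enum.to (+-identityʳ _) ⟩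
      enum.to (enum.from i)                ≡⟨ enum.strictlyInverseˡ i ⟩
      i                                    ∎
    translation : Permutation order order
    translation = permutation (shift x) (shift (- x))
      (λ i → shift-shift (- x) x i (-‿inverseˡ x)) (λ i → shift-shift x (- x) i (-‿inverseʳ x))

  -- The multiple 3^m · 1 vanishes. While 3 · 1 is nonzero it is invertible, and one factor 3 can be
  -- cancelled; if all are cancelled, then 1 = 0 and everything vanishes. The last case covers the
  -- one-element ring at m = 0, which `GF` admits.
  3×1≡0 : 3 ×ᵐ 1# ≡ 0#
  3×1≡0 = descend m (order×x≡0 1#)
    where
    open ≡-Reasoning
    descend : ∀ k → (3 ^ k) ×ᵐ 1# ≡ 0# → 3 ×ᵐ 1# ≡ 0#
    descend zero    1≡0 = begin
      3 ×ᵐ 1#         ≡⟨ *-identityʳ _ ⟨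
      3 ×ᵐ 1# * 1#    ≡⟨ cong (3 ×ᵐ 1# *_) (trans (sym (×-homo-1 1#)) 1≡0) ⟩
      3 ×ᵐ 1# * 0#    ≡⟨ zeroʳ _ ⟩
      0#              ∎
    descend (suc k) eq with (3 ×ᵐ 1#) ≟ 0#
    ... | yes three≡0 = three≡0
    ... | no  three≢0 with y , three*y≡1 ← inverse _ three≢0 = descend k (begin
      (3 ^ k) ×ᵐ 1#                        ≡⟨ *-identityʳ _ ⟨
      (3 ^ k) ×ᵐ 1# * 1#                   ≡⟨ cong ((3 ^ k) ×ᵐ 1# *_) three*y≡1 ⟨
      (3 ^ k) ×ᵐ 1# * (3 ×ᵐ 1# * y)        ≡⟨ *-assoc _ _ y ⟨
      (3 ^ k) ×ᵐ 1# * 3 ×ᵐ 1# * y          ≡⟨ cong (_* y) (*-comm _ _) ⟩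
      3 ×ᵐ 1# * (3 ^ k) ×ᵐ 1# * y          ≡⟨ cong (_* y) (×1-homo-* 3 (3 ^ k)) ⟨
      (3 ^ suc k) ×ᵐ 1# * y                ≡⟨ cong (_* y) eq ⟩
      0# * y                               ≡⟨ zeroˡ y ⟩
      0#                                   ∎)

  -- Characteristic 3 justifies the convention that `2₃` acts by negation.
  x+x≡-x : ∀ x → x + x ≡ - x
  x+x≡-x x = +-cancelˡ x _ _ (begin
    x + (x + x)            ≡⟨ cong (λ y → x + (x + y)) (+-identityʳ x) ⟨
    x + (x + (x + 0#))     ≡⟨ cong₂ _+_ (*-identityˡ x) (cong₂ _+_ (*-identityˡ x) (cong₂ _+_ (*-identityˡ x) (zeroˡ x))) ⟨
    1# * x + (1# * x + (1# * x + 0# * x))  ≡⟨ cong (λ y → 1# * x + (1# * x + y)) (distribʳ x 1# 0#) ⟨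
    1# * x + (1# * x + (1# + 0#) * x)      ≡⟨ cong (1# * x +_) (distribʳ x 1# _) ⟨
    1# * x + (1# + (1# + 0#)) * x          ≡⟨ distribʳ x 1# _ ⟨
    3 ×ᵐ 1# * x            ≡⟨ cong (_* x) 3×1≡0 ⟩
    0# * x                 ≡⟨ zeroˡ x ⟩
    0#                     ≡⟨ -‿inverseʳ x ⟨
    x + - x                ∎)
    where open ≡-Reasoning

  additive : Additive Carrier
  additive = record { plus = _+_ ; negate = -_ ; nil = 0# }

  open Additive additive using (act; scale; zeros; comb; eliminate)

  act-+ : ∀ u x y → act u (x + y) ≡ act u x + act u y
  act-+ 0₃ x y = sym (+-identityˡ 0#)
  act-+ 1₃ x y = refl
  act-+ 2₃ x y = sym (-‿+-comm x y)

  act-neg : ∀ u x → act (neg u) x ≡ - act u x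
  act-neg 0₃ x = sym -0#≈0#
  act-neg 1₃ x = refl
  act-neg 2₃ x = sym (-‿involutive x)

  act-add : ∀ u v x → act (add u v) x ≡ act u x + act v x
  act-add 0₃ v  x = sym (+-identityˡ _)
  act-add 1₃ 0₃ x = sym (+-identityʳ x)
  act-add 1₃ 1₃ x = sym (x+x≡-x x)
  act-add 1₃ 2₃ x = sym (-‿inverseʳ x)
  act-add 2₃ 0₃ x = sym (+-identityʳ (- x))
  act-add 2₃ 1₃ x = sym (-‿inverseˡ x)
  act-add 2₃ 2₃ x = trans (sym (-‿involutive x)) (trans (cong -_ (sym (x+x≡-x x))) (sym (-‿+-comm x x)))

  act-0 : ∀ u → act u 0# ≡ 0#
  act-0 0₃ = refl
  act-0 1₃ = refl
  act-0 2₃ = -0#≈0#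

  act-negate : ∀ u x → act u (- x) ≡ - act u x
  act-negate 0₃ x = sym -0#≈0#
  act-negate 1₃ x = refl
  act-negate 2₃ x = refl

  x-y+y≡x : ∀ x y → (x + - y) + y ≡ x
  x-y+y≡x x y = trans (+-assoc x (- y) y) (trans (cong (x +_) (-‿inverseˡ y)) (+-identityʳ x))

  x+y-y≡x : ∀ x y → (x + y) + - y ≡ x
  x+y-y≡x x y = trans (+-assoc x y (- y)) (trans (cong (x +_) (-‿inverseʳ y)) (+-identityʳ x))

  evaluation : ∀ x → Hom additive-F₃ additive (λ u → act u x)
  evaluation x = record
    { plus-homo   = λ u v → act-add u v x
    ; negate-homo = λ u → act-neg u x
    ; nil-homo    = refl
    }

  infixl 6 _⊞_ _⊟_

  _⊞_ _⊟_ : ∀ {r} → Vec Carrier r → Vec Carrier r → Vec Carrier r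
  _⊞_ = zipWith _+_
  _⊟_ = zipWith (λ x y → x + - y)

  ⊟-⊞ : ∀ {r} (x y : Vec Carrier r) → (x ⊟ y) ⊞ y ≡ x
  ⊟-⊞ []      []      = refl
  ⊟-⊞ (a ∷ x) (b ∷ y) = cong₂ _∷_ (x-y+y≡x a b) (⊟-⊞ x y)

  ⊞-⊟ : ∀ {r} (x y : Vec Carrier r) → (x ⊞ y) ⊟ y ≡ x
  ⊞-⊟ []      []      = refl
  ⊞-⊟ (a ∷ x) (b ∷ y) = cong₂ _∷_ (x+y-y≡x a b) (⊞-⊟ x y)

  ⊞-comm : ∀ {r} (x y : Vec Carrier r) → x ⊞ y ≡ y ⊞ x
  ⊞-comm = Vecₚ.zipWith-comm +-comm

  ⊞-identityˡ : ∀ {r} (x : Vec Carrier r) → zeros ⊞ x ≡ x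
  ⊞-identityˡ = Vecₚ.zipWith-identityˡ +-identityˡ

  ⊞-identityʳ : ∀ {r} (x : Vec Carrier r) → x ⊞ zeros ≡ x
  ⊞-identityʳ = Vecₚ.zipWith-identityʳ +-identityʳ

  ⊞-interchange : ∀ {r} (w x y z : Vec Carrier r) → (w ⊞ x) ⊞ (y ⊞ z) ≡ (w ⊞ y) ⊞ (x ⊞ z)
  ⊞-interchange []      []      []      []      = refl
  ⊞-interchange (a ∷ w) (b ∷ x) (c ∷ y) (d ∷ z) = cong₂ _∷_ (+-interchange a b c d) (⊞-interchange w x y z)

  x⊟x≡0 : ∀ {r} (x : Vec Carrier r) → x ⊟ x ≡ zeros
  x⊟x≡0 []      = refl
  x⊟x≡0 (a ∷ x) = cong₂ _∷_ (-‿inverseʳ a) (x⊟x≡0 x)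

  x⊟[x⊟y]≡y : ∀ {r} (x y : Vec Carrier r) → x ⊟ (x ⊟ y) ≡ y
  x⊟[x⊟y]≡y x y = begin
    x ⊟ (x ⊟ y)                  ≡⟨ cong (_⊟ (x ⊟ y)) (trans (sym (⊟-⊞ x y)) (⊞-comm _ y)) ⟩
    (y ⊞ (x ⊟ y)) ⊟ (x ⊟ y)      ≡⟨ ⊞-⊟ y (x ⊟ y) ⟩
    y                            ∎
    where open ≡-Reasoning

  scale-⊞ : ∀ {r} x y (c : Vec F₃ r) → scale (x + y) c ≡ scale x c ⊞ scale y c
  scale-⊞ x y []      = refl
  scale-⊞ x y (u ∷ c) = cong₂ _∷_ (act-+ u x y) (scale-⊞ x y c)

  scale-0 : ∀ {r} (c : Vec F₃ r) → scale 0# c ≡ zeros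
  scale-0 []      = refl
  scale-0 (u ∷ c) = cong₂ _∷_ (act-0 u) (scale-0 c)

  scale-zeros : ∀ x r → scale x (replicate r 0₃) ≡ zeros
  scale-zeros x zero    = refl
  scale-zeros x (suc r) = cong (0# ∷_) (scale-zeros x r)

  comb-⊞ : ∀ {r n} (cols : Vec (Vec F₃ r) n) x y → comb cols (x ⊞ y) ≡ comb cols x ⊞ comb cols y
  comb-⊞ []         []      []      = sym (⊞-identityˡ zeros)
  comb-⊞ (c ∷ cols) (a ∷ x) (b ∷ y) = trans (cong₂ _⊞_ (scale-⊞ a b c) (comb-⊞ cols x y)) (⊞-interchange _ _ _ _)

  comb-zeros : ∀ {r n} (cols : Vec (Vec F₃ r) n) → comb cols zeros ≡ zeros
  comb-zeros []         = refl
  comb-zeros (c ∷ cols) = trans (cong₂ _⊞_ (scale-0 c) (comb-zeros cols)) (⊞-identityˡ zeros)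

  comb-⊟ : ∀ {r n} (cols : Vec (Vec F₃ r) n) x y → comb cols (x ⊟ y) ≡ comb cols x ⊟ comb cols y
  comb-⊟ cols x y = begin
    comb cols (x ⊟ y)                                     ≡⟨ ⊞-⊟ _ (comb cols y) ⟨
    (comb cols (x ⊟ y) ⊞ comb cols y) ⊟ comb cols y       ≡⟨ cong (_⊟ comb cols y) (comb-⊞ cols (x ⊟ y) y) ⟨
    comb cols ((x ⊟ y) ⊞ y) ⊟ comb cols y                 ≡⟨ cong (λ z → comb cols z ⊟ comb cols y) (⊟-⊞ x y) ⟩
    comb cols x ⊟ comb cols y                             ∎
    where open ≡-Reasoning

  private
    pivot-⊞ : ∀ {r} (f : F₃ → F₃) (c : Vec F₃ r) a b x y →
      zipWith (λ u z → z + act (f u) (a + b)) c (x ⊞ y) ≡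
      zipWith (λ u z → z + act (f u) a) c x ⊞ zipWith (λ u z → z + act (f u) b) c y
    pivot-⊞ f []      a b []       []       = refl
    pivot-⊞ f (u ∷ c) a b (x ∷ xs) (y ∷ ys) = cong₂ _∷_
      (trans (cong (x + y +_) (act-+ (f u) a b)) (+-interchange x y _ _)) (pivot-⊞ f c a b xs ys)

    pivot-0 : ∀ {r} (f : F₃ → F₃) (c : Vec F₃ r) → zipWith (λ u z → z + act (f u) 0#) c zeros ≡ zeros
    pivot-0 f []      = refl
    pivot-0 f (u ∷ c) = cong₂ _∷_ (trans (+-identityˡ _) (act-0 (f u))) (pivot-0 f c)

  eliminate-⊞ : ∀ {r} (c : Vec F₃ (suc r)) x y → eliminate c (x ⊞ y) ≡ eliminate c x ⊞ eliminate c y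
  eliminate-⊞ {zero}  _        _       _       = refl
  eliminate-⊞ {suc r} (0₃ ∷ c) (a ∷ x) (b ∷ y) = cong (a + b ∷_) (eliminate-⊞ c x y)
  eliminate-⊞ {suc r} (1₃ ∷ c) (a ∷ x) (b ∷ y) = pivot-⊞ neg c a b x y
  eliminate-⊞ {suc r} (2₃ ∷ c) (a ∷ x) (b ∷ y) = pivot-⊞ id c a b x y

  eliminate-zeros : ∀ {r} (c : Vec F₃ (suc r)) → eliminate c zeros ≡ zeros
  eliminate-zeros {zero}  _        = refl
  eliminate-zeros {suc r} (0₃ ∷ c) = cong (0# ∷_) (eliminate-zeros c)
  eliminate-zeros {suc r} (1₃ ∷ c) = pivot-0 neg c
  eliminate-zeros {suc r} (2₃ ∷ c) = pivot-0 id c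

  eliminate-scale : ∀ {r} (c : Vec F₃ (suc r)) x d →
    eliminate c (scale x d) ≡ scale x (Additive.eliminate additive-F₃ c d)
  eliminate-scale c x d = sym (Hom.eliminate-homo (evaluation x) c d)

  eliminate-comb : ∀ {r n} (c : Vec F₃ (suc r)) (cols : Vec (Vec F₃ (suc r)) n) x →
    eliminate c (comb cols x) ≡ comb (contract c cols) x
  eliminate-comb c []         []      = eliminate-zeros c
  eliminate-comb c (d ∷ cols) (a ∷ x) =
    trans (eliminate-⊞ c _ _) (cong₂ _⊞_ (eliminate-scale c a d) (eliminate-comb c cols x))

  eliminate-self : ∀ {r} x (c : Vec F₃ (suc r)) → eliminate c (scale x c) ≡ zeros
  eliminate-self {zero}  x _        = refl
  eliminate-self {suc r} x (0₃ ∷ c) = cong (0# ∷_) (eliminate-self x c)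
  eliminate-self {suc r} x (1₃ ∷ c) = cancel c
    where
    cancel : ∀ {r} (c : Vec F₃ r) → zipWith (λ u y → y + act (neg u) x) c (scale x c) ≡ zeros
    cancel []      = refl
    cancel (u ∷ c) = cong₂ _∷_ (trans (cong (act u x +_) (act-neg u x)) (-‿inverseʳ _)) (cancel c)
  eliminate-self {suc r} x (2₃ ∷ c) = cancel c
    where
    cancel : ∀ {r} (c : Vec F₃ r) → zipWith (λ u y → y + act u (- x)) c (scale x c) ≡ zeros
    cancel []      = refl
    cancel (u ∷ c) = cong₂ _∷_ (trans (cong (act u x +_) (act-negate u x)) (-‿inverseʳ _)) (cancel c)

  -- Recovers x from `scale x c` at the first nonzero entry of c, as 1 and 2 are their own inverses;
  -- for c = 0 the default is 0.
  coefficient : ∀ {r} → Vec F₃ r → Vec Carrier r → Carrier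
  coefficient []       []      = 0#
  coefficient (0₃ ∷ c) (a ∷ x) = coefficient c x
  coefficient (1₃ ∷ c) (a ∷ x) = a
  coefficient (2₃ ∷ c) (a ∷ x) = - a

  coefficient-scale : ∀ {r} (c : Vec F₃ r) x → isZero c ≡ false → coefficient c (scale x c) ≡ x
  coefficient-scale (0₃ ∷ c) x c≢0 = coefficient-scale c x c≢0
  coefficient-scale (1₃ ∷ c) x c≢0 = refl
  coefficient-scale (2₃ ∷ c) x c≢0 = -‿involutive x

  -- Together with `eliminate-self` this identifies the kernel of `eliminate c` with the line of c:
  -- a vanishing eliminated entry says that the original entry is the right multiple of the pivot
  -- entry.
  scale-coefficient : ∀ {r} (c : Vec F₃ (suc r)) x → isZero c ≡ false → eliminate c x ≡ zeros →
    scale (coefficient c x) c ≡ x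
  scale-coefficient {zero}  (1₃ ∷ []) (a ∷ []) c≢0 eq = refl
  scale-coefficient {zero}  (2₃ ∷ []) (a ∷ []) c≢0 eq = cong (_∷ []) (-‿involutive a)
  scale-coefficient {suc r} (0₃ ∷ c)  (a ∷ x)  c≢0 eq =
    cong₂ _∷_ (sym (Vecₚ.∷-injectiveˡ eq)) (scale-coefficient c x c≢0 (Vecₚ.∷-injectiveʳ eq))
  scale-coefficient {suc r} (1₃ ∷ c)  (a ∷ x)  c≢0 eq = cong (a ∷_) (entries c x eq)
    where
    entries : ∀ {r} (c : Vec F₃ r) x → zipWith (λ u y → y + act (neg u) a) c x ≡ zeros → scale a c ≡ x
    entries []      []      _  = refl
    entries (u ∷ c) (b ∷ x) eq = cong₂ _∷_
      (+-cancelʳ (- act u a) _ _ (trans (-‿inverseʳ _)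
        (trans (sym (Vecₚ.∷-injectiveˡ eq)) (cong (b +_) (act-neg u a)))))
      (entries c x (Vecₚ.∷-injectiveʳ eq))
  scale-coefficient {suc r} (2₃ ∷ c)  (a ∷ x)  c≢0 eq = cong₂ _∷_ (-‿involutive a) (entries c x eq)
    where
    entries : ∀ {r} (c : Vec F₃ r) x → zipWith (λ u y → y + act u a) c x ≡ zeros → scale (- a) c ≡ x
    entries []      []      _  = refl
    entries (u ∷ c) (b ∷ x) eq = cong₂ _∷_
      (+-cancelʳ (act u a) _ _ (trans (cong (_+ act u a) (act-negate u a)) (trans (-‿inverseˡ _)
        (sym (Vecₚ.∷-injectiveˡ eq)))))
      (entries c x (Vecₚ.∷-injectiveʳ eq))

-- Counting solutions by deletion and contraction

module Counting {m : ℕ} (F : GF m) where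

  open GF F
  open FieldProperties F
  open Additive additive using (act; scale; zeros; comb; eliminate)

  elements-listing : Listing (λ _ → ⊤) elements
  elements-listing = record
    { unique   = Unique.map⁺ (λ {i} {j} eq → trans (sym (enum.strictlyInverseˡ i))
                   (trans (cong enum.to eq) (enum.strictlyInverseˡ j))) (Unique.allFin⁺ order)
    ; sound    = λ _ → tt
    ; complete = λ {x} _ → subst (_∈ elements) (enum.strictlyInverseʳ x)
                   (∈-map⁺ enum.from (∈-allFin (enum.to x)))
    }

  length-elements : length elements ≡ order
  length-elements = trans (length-map enum.from (List.allFin order)) (length-tabulate {n = order} id)

  -- Propositional equality of functions is not extensional, so words are compared and counted as
  -- vectors.
  vecs : ∀ n → List (Vec Carrier n)
  vecs n = List.map tabulate (allVecs n)

  vecs-suc : ∀ n → vecs (suc n) ≡ List.cartesianProductWith _∷_ elements (vecs n)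
  vecs-suc n = go elements
    where
    go : ∀ xs → List.map tabulate (List.concatMap (λ a → List.map (a VF.∷_) (allVecs n)) xs) ≡
                List.cartesianProductWith _∷_ xs (vecs n)
    go []       = refl
    go (a ∷ xs) = trans (map-++ tabulate (List.map (a VF.∷_) (allVecs n)) _)
      (cong₂ _++_ (trans (sym (map-∘ (allVecs n))) (map-∘ (allVecs n))) (go xs))

  vecs-unique : ∀ n → Unique (vecs n)
  vecs-unique zero    = [] ∷ []
  vecs-unique (suc n) = subst Unique (sym (vecs-suc n))
    (Unique.cartesianProductWith⁺ _∷_ Vecₚ.∷-injective (unique elements-listing) (vecs-unique n))

  vecs-complete : ∀ {n} (x : Vec Carrier n) → x ∈ vecs n
  vecs-complete []      = here refl
  vecs-complete (a ∷ x) = subst (a ∷ x ∈_) (sym (vecs-suc _))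
    (∈-cartesianProductWith⁺ _∷_ (complete elements-listing tt) (vecs-complete x))

  filter-vecs : ∀ {n} {P : Vec Carrier n → Set} (P? : Decidable P) → Listing P (filter P? (vecs n))
  filter-vecs {n} P? = record
    { unique   = Unique.filter⁺ P? (vecs-unique n)
    ; sound    = λ x∈ → proj₂ (∈-filter⁻ P? {xs = vecs n} x∈)
    ; complete = λ p → ∈-filter⁺ P? (vecs-complete _) p
    }

  _≟ᵛ_ : ∀ {n} (x y : Vec Carrier n) → Dec (x ≡ y)
  _≟ᵛ_ = Vecₚ.≡-dec _≟_

  weight : ∀ {n} → Vec Carrier n → ℕ
  weight []      = 0
  weight (a ∷ x) = if does (a ≟ 0#) then weight x else suc (weight x)

  weight-0∷ : ∀ {n} (x : Vec Carrier n) → weight (0# ∷ x) ≡ weight x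
  weight-0∷ x with 0# ≟ 0#
  ... | yes _   = refl
  ... | no  0≢0 = contradiction refl 0≢0

  weight-∷ : ∀ {n a} (x : Vec Carrier n) → a ≢ 0# → weight (a ∷ x) ≡ suc (weight x)
  weight-∷ {a = a} x a≢0 with a ≟ 0#
  ... | yes a≡0 = contradiction a≡0 a≢0
  ... | no  _   = refl

  weight≡0⇒zeros : ∀ {n} (x : Vec Carrier n) → weight x ≡ 0 → x ≡ zeros
  weight≡0⇒zeros []      _  = refl
  weight≡0⇒zeros (a ∷ x) eq with a ≟ 0#
  ... | yes refl = cong (0# ∷_) (weight≡0⇒zeros x eq)
  weight≡0⇒zeros (a ∷ x) () | no _

  Solution : ∀ {r n} → Vec (Vec F₃ r) n → Vec Carrier r → ℕ → Vec Carrier n → Set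
  Solution cols s j e = comb cols e ≡ s × weight e ≡ j

  solution? : ∀ {r n} (cols : Vec (Vec F₃ r) n) s j → Decidable (Solution cols s j)
  solution? cols s j e = (comb cols e ≟ᵛ s) ×-dec (weight e ℕ.≟ j)

  solutions : ∀ {r n} → Vec (Vec F₃ r) n → Vec Carrier r → ℕ → ℕ
  solutions {n = n} cols s j = length (filter (solution? cols s j) (vecs n))

  Nonzero : ∀ {n} → Vec Carrier (suc n) → Set
  Nonzero e = ¬ (head e ≡ 0#)

  nonzero? : ∀ {n} → Decidable (Nonzero {n})
  nonzero? e = ¬? (head e ≟ 0#)

  usingHead : ∀ {r n} → Vec (Vec F₃ r) (suc n) → Vec Carrier r → ℕ → ℕ
  usingHead {n = n} cols s j = length (filter (λ e → solution? cols s j e ×-dec nonzero? e) (vecs (suc n)))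

  comb-0∷ : ∀ {r n} c (cols : Vec (Vec F₃ r) n) e → comb (c ∷ cols) (0# ∷ e) ≡ comb cols e
  comb-0∷ c cols e = trans (cong (_⊞ comb cols e) (scale-0 c)) (⊞-identityˡ _)

  avoidingHead : ∀ {r n} c (cols : Vec (Vec F₃ r) n) s j →
    length (filter (λ e → solution? (c ∷ cols) s j e ×-dec (head e ≟ 0#)) (vecs (suc n))) ≡ solutions cols s j
  avoidingHead c cols s j = bijection⇒length≡
    (filter-vecs (λ e → solution? (c ∷ cols) s j e ×-dec (head e ≟ 0#)))
    (filter-vecs (solution? cols s j))
    tail (0# ∷_)
    (λ { {a ∷ e} ((sol , wt) , refl) → trans (sym (comb-0∷ c cols e)) sol , trans (sym (weight-0∷ e)) wt })
    (λ { {e} (sol , wt) → (trans (comb-0∷ c cols e) sol , trans (weight-0∷ e) wt) , refl })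
    (λ { {a ∷ e} (_ , refl) → refl })
    (λ _ → refl)

  solutions-split : ∀ {r n} c (cols : Vec (Vec F₃ r) n) s j →
    solutions (c ∷ cols) s j ≡ solutions cols s j ℕ.+ usingHead (c ∷ cols) s j
  solutions-split {n = n} c cols s j = trans
    (length-filter-split (solution? (c ∷ cols) s j) (λ e → head e ≟ 0#) (vecs (suc n)))
    (cong (ℕ._+ usingHead (c ∷ cols) s j) (avoidingHead c cols s j))

  usingHead-0 : ∀ {r n} (cols : Vec (Vec F₃ r) (suc n)) s → usingHead cols s 0 ≡ 0
  usingHead-0 {n = n} cols s = none⇒length≡0 (filter-vecs {suc n} _)
    (λ { {a ∷ e} ((_ , wt) , a≢0) → contradiction (trans (sym (weight-∷ e a≢0)) wt) λ () })

  -- A nonzero column determines its own coordinate: what the other columns leave of s must be a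
  -- multiple of c, and `value e` is the factor. Hence prepending `value e` inverts dropping the
  -- head.
  module Pivot {r n} (c : Vec F₃ (suc r)) (c≢0 : isZero c ≡ false) (cols : Vec (Vec F₃ (suc r)) n) (s : Vec Carrier (suc r)) where

    open ≡-Reasoning

    value : Vec Carrier n → Carrier
    value e = coefficient c (s ⊟ comb cols e)

    value-unique : ∀ a e → comb (c ∷ cols) (a ∷ e) ≡ s → value e ≡ a
    value-unique a e sol = begin
      coefficient c (s ⊟ comb cols e)                           ≡⟨ cong (λ y → coefficient c (y ⊟ comb cols e)) sol ⟨
      coefficient c ((scale a c ⊞ comb cols e) ⊟ comb cols e)   ≡⟨ cong (coefficient c) (⊞-⊟ (scale a c) _) ⟩
      coefficient c (scale a c)                                 ≡⟨ coefficient-scale c a c≢0 ⟩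
      a                                                         ∎

    contracted : ∀ a e → comb (c ∷ cols) (a ∷ e) ≡ s → comb (contract c cols) e ≡ eliminate c s
    contracted a e sol = begin
      comb (contract c cols) e                              ≡⟨ eliminate-comb c cols e ⟨
      eliminate c (comb cols e)                             ≡⟨ ⊞-identityˡ _ ⟨
      zeros ⊞ eliminate c (comb cols e)                     ≡⟨ cong (_⊞ eliminate c (comb cols e)) (eliminate-self a c) ⟨
      eliminate c (scale a c) ⊞ eliminate c (comb cols e)   ≡⟨ eliminate-⊞ c _ _ ⟨
      eliminate c (scale a c ⊞ comb cols e)                 ≡⟨ cong (eliminate c) sol ⟩
      eliminate c s                                         ∎

    uncontracted : ∀ e → comb (contract c cols) e ≡ eliminate c s → comb (c ∷ cols) (value e ∷ e) ≡ s
    uncontracted e sol = begin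
      scale (value e) c ⊞ comb cols e      ≡⟨ cong (_⊞ comb cols e) (scale-coefficient c _ c≢0 killed) ⟩
      (s ⊟ comb cols e) ⊞ comb cols e      ≡⟨ ⊟-⊞ s _ ⟩
      s                                    ∎
      where
      killed : eliminate c (s ⊟ comb cols e) ≡ zeros
      killed = begin
        eliminate c (s ⊟ comb cols e)
          ≡⟨ ⊞-⊟ _ _ ⟨
        (eliminate c (s ⊟ comb cols e) ⊞ eliminate c (comb cols e)) ⊟ eliminate c (comb cols e)
          ≡⟨ cong (_⊟ eliminate c (comb cols e)) (eliminate-⊞ c _ _) ⟨
        eliminate c ((s ⊟ comb cols e) ⊞ comb cols e) ⊟ eliminate c (comb cols e)
          ≡⟨ cong₂ (λ y z → eliminate c y ⊟ z) (⊟-⊞ s _) (trans (eliminate-comb c cols e) sol) ⟩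
        eliminate c s ⊟ eliminate c s
          ≡⟨ x⊟x≡0 _ ⟩
        zeros ∎

  -- Deletion and contraction: dropping the head coordinate turns solutions for
  -- c ∷ cols into solutions of the contracted system, where those with head
  -- coordinate 0 are exactly the solutions for cols.
  usingHead-pivot : ∀ {r n} (c : Vec F₃ (suc r)) (cols : Vec (Vec F₃ (suc r)) n) s j → isZero c ≡ false →
    solutions (contract c cols) (eliminate c s) j ≡ solutions cols s j ℕ.+ usingHead (c ∷ cols) s (suc j)
  usingHead-pivot {n = n} c cols s j c≢0 = trans
    (length-filter-split (solution? (contract c cols) (eliminate c s) j) (λ e → comb cols e ≟ᵛ s) (vecs n))
    (cong₂ ℕ._+_ old new)
    where
    open Pivot c c≢0 cols s

    old : length (filter (λ e → solution? (contract c cols) (eliminate c s) j e ×-dec (comb cols e ≟ᵛ s)) (vecs n)) ≡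
          solutions cols s j
    old = bijection⇒length≡
      (filter-vecs (λ e → solution? (contract c cols) (eliminate c s) j e ×-dec (comb cols e ≟ᵛ s)))
      (filter-vecs (solution? cols s j)) id id
      (λ ((_ , wt) , sol) → sol , wt)
      (λ {e} (sol , wt) → (trans (sym (eliminate-comb c cols e)) (cong (eliminate c) sol) , wt) , sol)
      (λ _ → refl) (λ _ → refl)

    new : length (filter (λ e → solution? (contract c cols) (eliminate c s) j e ×-dec ¬? (comb cols e ≟ᵛ s)) (vecs n)) ≡
          usingHead (c ∷ cols) s (suc j)
    new = bijection⇒length≡
      (filter-vecs (λ e → solution? (contract c cols) (eliminate c s) j e ×-dec ¬? (comb cols e ≟ᵛ s)))
      (filter-vecs (λ e → solution? (c ∷ cols) s (suc j) e ×-dec nonzero? e))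
      (λ e → value e ∷ e) tail
      (λ { {e} ((sol , wt) , ¬sol) →
        let value≢0 : value e ≢ 0#
            value≢0 eq = ¬sol (trans (sym (comb-0∷ c cols e))
              (trans (cong (λ a → comb (c ∷ cols) (a ∷ e)) (sym eq)) (uncontracted e sol)))
        in (uncontracted e sol , trans (weight-∷ e value≢0) (cong suc wt)) , value≢0 })
      (λ { {a ∷ e} ((sol , wt) , a≢0) →
        (contracted a e sol , ℕₚ.suc-injective (trans (sym (weight-∷ e a≢0)) wt)) ,
        λ sol₀ → a≢0 (trans (sym (value-unique a e sol)) (value-unique 0# e (trans (comb-0∷ c cols e) sol₀))) })
      (λ _ → refl)
      (λ { {a ∷ e} ((sol , _) , _) → cong (_∷ e) (value-unique a e sol) })

  comb-zero∷ : ∀ {r n} (c : Vec F₃ r) (cols : Vec (Vec F₃ r) n) a e → isZero c ≡ true →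
    comb (c ∷ cols) (a ∷ e) ≡ comb cols e
  comb-zero∷ {r} c cols a e c≡0 = trans (cong (λ d → scale a d ⊞ comb cols e) (isZero-true c c≡0))
    (trans (cong (_⊞ comb cols e) (scale-zeros a r)) (⊞-identityˡ _))

  nonzeros : List Carrier
  nonzeros = filter (λ a → ¬? (a ≟ 0#)) elements

  length-nonzeros : length nonzeros ≡ order ∸ 1
  length-nonzeros = cong (_∸ 1) (begin
    suc (length nonzeros)                                        ≡⟨ cong (ℕ._+ length nonzeros) singleton ⟨
    length (filter (_≟ 0#) elements) ℕ.+ length nonzeros         ≡⟨ partition elements ⟨
    length elements                                              ≡⟨ length-elements ⟩
    order                                                        ∎)
    where
    open ≡-Reasoning
    partition : ∀ xs → length xs ≡ length (filter (_≟ 0#) xs) ℕ.+ length (filter (λ a → ¬? (a ≟ 0#)) xs)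
    partition []       = refl
    partition (a ∷ xs) with does (a ≟ 0#)
    ... | true  = cong suc (partition xs)
    ... | false = trans (cong suc (partition xs)) (sym (ℕₚ.+-suc _ _))
    singleton : length (filter (_≟ 0#) elements) ≡ 1
    singleton = bijection⇒length≡ {Q = _≡ 0#} {ys = 0# ∷ []} (filter-listing (_≟ 0#) elements-listing)
      (record { unique = [] ∷ [] ; sound = λ { (here refl) → refl } ; complete = λ { refl → here refl } })
      id id proj₂ (λ eq → tt , eq) (λ _ → refl) (λ _ → refl)

  -- A zero column does not affect the syndrome, so the head may be any nonzero element,
  -- independently of the tail.
  usingHead-zero : ∀ {r n} (c : Vec F₃ r) (cols : Vec (Vec F₃ r) n) s j → isZero c ≡ true →
    usingHead (c ∷ cols) s (suc j) ≡ (order ∸ 1) ℕ.* solutions cols s j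
  usingHead-zero {r} {n} c cols s j c≡0 = begin
    usingHead (c ∷ cols) s (suc j)                              ≡⟨ bijection⇒length≡
      (filter-vecs (λ e → solution? (c ∷ cols) s (suc j) e ×-dec nonzero? e)) products id id
      id id (λ _ → refl) (λ _ → refl) ⟩
    length (List.cartesianProductWith _∷_ nonzeros sols)        ≡⟨ length-cartesianProductWith _∷_ nonzeros sols ⟩
    length nonzeros ℕ.* length sols                             ≡⟨ cong (ℕ._* length sols) length-nonzeros ⟩
    (order ∸ 1) ℕ.* solutions cols s j                          ∎
    where
    open ≡-Reasoning
    sols : List (Vec Carrier n)
    sols = filter (solution? cols s j) (vecs n)

    sols-listing : Listing (Solution cols s j) sols
    sols-listing = filter-vecs (solution? cols s j)

    nonzeros-listing : Listing (λ a → ⊤ × a ≢ 0#) nonzeros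
    nonzeros-listing = filter-listing (λ a → ¬? (a ≟ 0#)) elements-listing

    products : Listing (λ e → Solution (c ∷ cols) s (suc j) e × Nonzero e)
                       (List.cartesianProductWith _∷_ nonzeros sols)
    products = record
      { unique   = Unique.cartesianProductWith⁺ _∷_ Vecₚ.∷-injective (unique nonzeros-listing) (unique sols-listing)
      ; sound    = λ x∈ → case-sound (∈-cartesianProductWith⁻ _∷_ nonzeros sols x∈)
      ; complete = λ { {a ∷ e} ((sol , wt) , a≢0) → ∈-cartesianProductWith⁺ _∷_
          (complete nonzeros-listing (tt , a≢0))
          (complete sols-listing (trans (sym (comb-zero∷ c cols a e c≡0)) sol ,
            ℕₚ.suc-injective (trans (sym (weight-∷ e a≢0)) wt))) }
      }
      where
      case-sound : ∀ {e} → (∃ λ a → ∃ λ e′ → a ∈ nonzeros × e′ ∈ sols × e ≡ a ∷ e′) →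
        Solution (c ∷ cols) s (suc j) e × Nonzero e
      case-sound (a , e , a∈ , e∈ , refl) =
        let a≢0 = proj₂ (sound nonzeros-listing a∈)
            sol , wt = sound sols-listing e∈
        in (trans (comb-zero∷ c cols a e c≡0) sol , trans (weight-∷ e a≢0) (cong suc wt)) , a≢0

  isZero# : Carrier → Bool
  isZero# a = does (a ≟ 0#)

  allZero-zeros : ∀ r → allZero additive isZero# (zeros {r}) ≡ true
  allZero-zeros zero    = refl
  allZero-zeros (suc r) with 0# ≟ 0#
  ... | yes _   = allZero-zeros r
  ... | no  0≢0 = contradiction refl 0≢0

  solutions-0 : ∀ {r n} (cols : Vec (Vec F₃ r) n) s →
    solutions cols s 0 ≡ (if allZero additive isZero# s then 1 else 0)
  solutions-0 {r} []     s with zeros ≟ᵛ s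
  ... | yes refl = cong (if_then 1 else 0) (sym (allZero-zeros r))
  ... | no ¬0≡s = cong (if_then 1 else 0) (sym (¬allZero s ¬0≡s))
    where
    ¬allZero : ∀ {r} (s : Vec Carrier r) → zeros ≢ s → allZero additive isZero# s ≡ false
    ¬allZero []      ¬0≡s = contradiction refl ¬0≡s
    ¬allZero (a ∷ s) ¬0≡s with a ≟ 0#
    ... | yes refl = ¬allZero s (¬0≡s ∘ cong (0# ∷_))
    ... | no  _    = refl
  solutions-0 (c ∷ cols) s = trans (solutions-split c cols s 0)
    (trans (cong (solutions cols s 0 ℕ.+_) (usingHead-0 (c ∷ cols) s)) (trans (ℕₚ.+-identityʳ _) (solutions-0 cols s)))

  solutions-[] : ∀ {r} (s : Vec Carrier r) j → solutions [] s (suc j) ≡ 0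
  solutions-[] s j = none⇒length≡0 (filter-vecs (solution? [] s (suc j))) λ { {[]} (_ , ()) }

-- Minimal solutions, minimum distance and dimension

module Coverage {m : ℕ} (F : GF m) where

  open GF F
  open FieldProperties F
  open Counting F
  open Additive additive using (act; scale; zeros; comb; eliminate)

  solutions≤ : ∀ {r n} c (cols : Vec (Vec F₃ r) n) s j → solutions (c ∷ cols) s j ≡ 0 → solutions cols s j ≡ 0
  solutions≤ c cols s j eq = ℕₚ.m+n≡0⇒m≡0 _ (trans (sym (solutions-split c cols s j)) eq)

  usingHead≤ : ∀ {r n} c (cols : Vec (Vec F₃ r) n) s j → solutions (c ∷ cols) s j ≡ 0 → usingHead (c ∷ cols) s j ≡ 0
  usingHead≤ c cols s j eq = ℕₚ.m+n≡0⇒n≡0 (solutions cols s j) (trans (sym (solutions-split c cols s j)) eq)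

  -- Below the least weight of a solution nothing is lost in a contraction, so a
  -- minimal solution is determined by its support, an independent set.
  solutions-minimal : ∀ {r n} (cols : Vec (Vec F₃ r) n) s j → (∀ {i} → i < j → solutions cols s i ≡ 0) →
    solutions cols s j ≡ count additive isZero# (trie cols j) s
  solutions-minimal         cols       s  zero    min = solutions-0 cols s
  solutions-minimal         []         s  (suc j) min = solutions-[] s j
  -- With no equations the zero vector is a solution of weight 0, against minimality.
  solutions-minimal {zero}  (c ∷ cols) [] (suc j) min =
    contradiction (trans (sym (solutions-0 (c ∷ cols) [])) (min (s≤s z≤n))) λ ()
  solutions-minimal {suc r} (c ∷ cols) s  (suc j) min with isZero c in eq
  ... | true  = begin
    solutions (c ∷ cols) s (suc j)
      ≡⟨ solutions-split c cols s (suc j) ⟩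
    solutions cols s (suc j) ℕ.+ usingHead (c ∷ cols) s (suc j)
      ≡⟨ cong (solutions cols s (suc j) ℕ.+_) (usingHead-zero c cols s j eq) ⟩
    solutions cols s (suc j) ℕ.+ (order ∸ 1) ℕ.* solutions cols s j
      ≡⟨ cong (λ k → solutions cols s (suc j) ℕ.+ (order ∸ 1) ℕ.* k) (solutions≤ c cols s j (min ℕₚ.≤-refl)) ⟩
    solutions cols s (suc j) ℕ.+ (order ∸ 1) ℕ.* 0
      ≡⟨ trans (cong (solutions cols s (suc j) ℕ.+_) (ℕₚ.*-zeroʳ (order ∸ 1))) (ℕₚ.+-identityʳ _) ⟩
    solutions cols s (suc j)
      ≡⟨ solutions-minimal cols s (suc j) (λ {i} i<j → solutions≤ c cols s i (min i<j)) ⟩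
    count additive isZero# (trie cols (suc j)) s ∎
    where open ≡-Reasoning
  ... | false = begin
    solutions (c ∷ cols) s (suc j)
      ≡⟨ solutions-split c cols s (suc j) ⟩
    solutions cols s (suc j) ℕ.+ usingHead (c ∷ cols) s (suc j)
      ≡⟨ ℕₚ.+-comm (solutions cols s (suc j)) _ ⟩
    usingHead (c ∷ cols) s (suc j) ℕ.+ solutions cols s (suc j)
      ≡⟨ cong₂ ℕ._+_ contracted (solutions-minimal cols s (suc j) (λ {i} i<j → solutions≤ c cols s i (min i<j))) ⟩
    count additive isZero# (trie (contract c cols) j) (eliminate c s) ℕ.+ count additive isZero# (trie cols (suc j)) s ∎
    where
    open ≡-Reasoning
    contracted : usingHead (c ∷ cols) s (suc j) ≡ count additive isZero# (trie (contract c cols) j) (eliminate c s)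
    contracted = begin
      usingHead (c ∷ cols) s (suc j)
        ≡⟨ cong (ℕ._+ usingHead (c ∷ cols) s (suc j)) (solutions≤ c cols s j (min ℕₚ.≤-refl)) ⟨
      solutions cols s j ℕ.+ usingHead (c ∷ cols) s (suc j)
        ≡⟨ usingHead-pivot c cols s j eq ⟨
      solutions (contract c cols) (eliminate c s) j
        -- Minimality survives contraction: a contracted solution of weight i < j comes from a
        -- solution of weight i or i + 1, and both are below j + 1.
        ≡⟨ solutions-minimal (contract c cols) (eliminate c s) j (λ {i} i<j → trans (usingHead-pivot c cols s i eq)
             (cong₂ ℕ._+_ (solutions≤ c cols s i (min (ℕₚ.m<n⇒m<1+n i<j)))
                          (usingHead≤ c cols s (suc i) (min (s≤s i<j))))) ⟩
      count additive isZero# (trie (contract c cols) j) (eliminate c s) ∎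

  -- Coefficients on j columns whose span contains s form a solution of weight at most j; some may
  -- vanish, so the weight can be smaller.
  count≢0⇒near : ∀ {r n} (cols : Vec (Vec F₃ r) n) s j → count additive isZero# (trie cols j) s ≢ 0 →
    ∃ λ i → i ≤ j × solutions cols s i ≢ 0
  count≢0⇒near         cols       s zero    ≢0 = 0 , z≤n , ≢0 ∘ trans (sym (solutions-0 cols s))
  count≢0⇒near         []         s (suc j) ≢0 = contradiction refl ≢0
  count≢0⇒near {zero}  (c ∷ cols) s (suc j) ≢0 = contradiction refl ≢0
  count≢0⇒near {suc r} (c ∷ cols) s (suc j) ≢0 with isZero c in eq
  ... | true  = let i , i≤ , ≢0′ = count≢0⇒near cols s (suc j) ≢0 in i , i≤ , ≢0′ ∘ solutions≤ c cols s i
  ... | false with count additive isZero# (trie (contract c cols) j) (eliminate c s) in zero-count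
  ...   | zero  = let i , i≤ , ≢0′ = count≢0⇒near cols s (suc j) ≢0 in i , i≤ , ≢0′ ∘ solutions≤ c cols s i
  ...   | suc _ with count≢0⇒near (contract c cols) (eliminate c s) j (λ c≡0 → contradiction (trans (sym zero-count) c≡0) λ ())
  -- A contracted solution either solves the system without c already, or gains a nonzero coordinate
  -- at c and has weight i + 1.
  ...     | i , i≤j , ≢0′ with solutions cols s i ℕ.≟ 0
  ...       | no  old≢0 = i , ℕₚ.m≤n⇒m≤1+n i≤j , old≢0 ∘ solutions≤ c cols s i
  ...       | yes old≡0 = suc i , s≤s i≤j , λ eq′ → ≢0′
    (trans (usingHead-pivot c cols s i eq) (cong₂ ℕ._+_ old≡0 (usingHead≤ c cols s (suc i) eq′)))

  -- After r contractions nothing is left of s: r independent columns span every syndrome.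
  count-bases : ∀ {r n} (cols : Vec (Vec F₃ r) n) s → count additive isZero# (trie cols r) s ≡ bases cols
  count-bases {zero}  cols       []  = refl
  count-bases {suc r} []         s   = refl
  count-bases {suc r} (c ∷ cols) s with isZero c
  ... | true  = count-bases cols s
  ... | false = cong₂ ℕ._+_ (count-bases (contract c cols) (eliminate c s)) (count-bases cols s)

  -- The support of a nonzero kernel vector is a dependent set of columns. Independence is tested
  -- over 𝔽₃, so the bound holds over every extension and lifting does not lower the minimum
  -- distance.
  separated⇒no-light : ∀ {r n} (cols : Vec (Vec F₃ r) n) d → separated cols d ≡ true →
    ∀ {i} → i < d → solutions cols zeros (suc i) ≡ 0
  separated⇒no-light {r}     []         (suc d) sep {i} i<d = solutions-[] (zeros {r}) i
  separated⇒no-light {suc r} (c ∷ cols) (suc d) sep {i} i<d with isZero c in eq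
  ... | false with separated (contract c cols) d in sep₁
  ...   | true = trans (solutions-split c cols zeros (suc i))
    (cong₂ ℕ._+_ (separated⇒no-light cols (suc d) sep i<d) (head-unused i i<d))
    where
    open ≡-Reasoning
    head-unused : ∀ i → i < suc d → usingHead (c ∷ cols) zeros (suc i) ≡ 0
    -- Weight 0 is attained by the zero vector alone, both for the remaining columns and for the
    -- contracted ones, which leaves no solution that uses the head.
    head-unused zero    _         = ℕₚ.+-cancelˡ-≡ 1 _ _ (begin
      1 ℕ.+ usingHead (c ∷ cols) zeros 1                           ≡⟨ cong (ℕ._+ usingHead (c ∷ cols) zeros 1) (one cols) ⟨
      solutions cols zeros 0 ℕ.+ usingHead (c ∷ cols) zeros 1      ≡⟨ usingHead-pivot c cols zeros 0 eq ⟨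
      solutions (contract c cols) (eliminate c zeros) 0            ≡⟨ cong (λ s → solutions (contract c cols) s 0) (eliminate-zeros c) ⟩
      solutions (contract c cols) zeros 0                          ≡⟨ one (contract c cols) ⟩
      1                                                            ∎)
      where
      one : ∀ {r n} (cols : Vec (Vec F₃ r) n) → solutions cols zeros 0 ≡ 1
      one {r} cols = trans (solutions-0 cols zeros) (cong (if_then 1 else 0) (allZero-zeros r))
    head-unused (suc i) (s≤s i<d) = ℕₚ.m+n≡0⇒n≡0 (solutions cols zeros (suc i)) (begin
      solutions cols zeros (suc i) ℕ.+ usingHead (c ∷ cols) zeros (suc (suc i))  ≡⟨ usingHead-pivot c cols zeros (suc i) eq ⟨
      solutions (contract c cols) (eliminate c zeros) (suc i)  ≡⟨ cong (λ s → solutions (contract c cols) s (suc i)) (eliminate-zeros c) ⟩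
      solutions (contract c cols) zeros (suc i)                ≡⟨ separated⇒no-light (contract c cols) d sep₁ i<d ⟩
      0                                                        ∎)

  kernel? : ∀ {r n} (cols : Vec (Vec F₃ r) n) → Decidable (λ e → comb cols e ≡ zeros)
  kernel? cols e = comb cols e ≟ᵛ zeros

  kernel : ∀ {r n} → Vec (Vec F₃ r) n → List (Vec Carrier n)
  kernel {n = n} cols = filter (kernel? cols) (vecs n)

  -- Rank and nullity by counting: a zero column multiplies the size of the kernel by the order of
  -- the field, and a nonzero one puts the kernel in bijection with that of the contracted columns.
  length-kernel : ∀ {r n} (cols : Vec (Vec F₃ r) n) → length (kernel cols) ≡ order ^ nullity cols
  length-kernel-zero : ∀ {r n} c (cols : Vec (Vec F₃ r) n) → isZero c ≡ true →
    length (kernel (c ∷ cols)) ≡ order ^ suc (nullity cols)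
  length-kernel-zero c cols c≡0 = begin
    length (kernel (c ∷ cols))
      ≡⟨ bijection⇒length≡ (filter-vecs (kernel? (c ∷ cols))) products id id id id (λ _ → refl) (λ _ → refl) ⟩
    length (List.cartesianProductWith _∷_ elements (kernel cols))
      ≡⟨ length-cartesianProductWith _∷_ elements (kernel cols) ⟩
    length elements ℕ.* length (kernel cols)
      ≡⟨ cong₂ ℕ._*_ length-elements (length-kernel cols) ⟩
    order ^ suc (nullity cols) ∎
    where
    open ≡-Reasoning
    kernel-listing : Listing (λ e → comb cols e ≡ zeros) (kernel cols)
    kernel-listing = filter-vecs (kernel? cols)
    products : Listing (λ e → comb (c ∷ cols) e ≡ zeros) (List.cartesianProductWith _∷_ elements (kernel cols))
    products = record
      { unique   = Unique.cartesianProductWith⁺ _∷_ Vecₚ.∷-injective (unique elements-listing) (unique kernel-listing)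
      ; sound    = λ x∈ → combine (∈-cartesianProductWith⁻ _∷_ elements (kernel cols) x∈)
      ; complete = λ { {a ∷ e} sol → ∈-cartesianProductWith⁺ _∷_ (complete elements-listing tt)
          (complete kernel-listing (trans (sym (comb-zero∷ c cols a e c≡0)) sol)) }
      }
      where
      combine : ∀ {e} → (∃ λ a → ∃ λ e′ → a ∈ elements × e′ ∈ kernel cols × e ≡ a ∷ e′) → comb (c ∷ cols) e ≡ zeros
      combine (a , e , _ , e∈ , refl) = trans (comb-zero∷ c cols a e c≡0) (sound kernel-listing e∈)

  length-kernel {r}     []         = cong length (filter-accept (kernel? {r} []) {x = []} {xs = []} refl)
  length-kernel {zero}  ([] ∷ cols) = length-kernel-zero [] cols refl
  length-kernel {suc r} (c ∷ cols) with isZero c in eq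
  ... | true  = length-kernel-zero c cols eq
  ... | false = trans
    (bijection⇒length≡ (filter-vecs (kernel? (c ∷ cols))) (filter-vecs (kernel? (contract c cols)))
      tail (λ e → value e ∷ e)
      (λ { {a ∷ e} sol → trans (contracted a e sol) (eliminate-zeros c) })
      (λ {e} sol → uncontracted e (trans sol (sym (eliminate-zeros c))))
      (λ { {a ∷ e} sol → cong (_∷ e) (value-unique a e sol) })
      (λ _ → refl))
    (length-kernel (contract c cols))
    where open Pivot c eq cols zeros

  nullity≡0⇒injective : ∀ {r n} (cols : Vec (Vec F₃ r) n) → nullity cols ≡ 0 → ∀ x y → comb cols x ≡ comb cols y → x ≡ y
  nullity≡0⇒injective cols null x y eq = begin
    x                 ≡⟨ ⊟-⊞ x y ⟨
    (x ⊟ y) ⊞ y       ≡⟨ cong (_⊞ y) trivial ⟩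
    zeros ⊞ y         ≡⟨ ⊞-identityˡ y ⟩
    y                 ∎
    where
    open ≡-Reasoning
    singleton : ∀ {A : Set} {x y : A} {xs} → length xs ≡ 1 → x ∈ xs → y ∈ xs → x ≡ y
    singleton {xs = _ ∷ []} _ (here refl) (here refl) = refl
    trivial : x ⊟ y ≡ zeros
    trivial = singleton (trans (length-kernel cols) (cong (order ^_) null))
      (complete (filter-vecs (kernel? cols)) (trans (comb-⊟ cols x y) (trans (cong (_⊟ comb cols y) eq) (x⊟x≡0 _))))
      (complete (filter-vecs (kernel? cols)) (comb-zeros cols))

-- Coordinates of a syndrome over 𝔽₃

allF₃-unique : ∀ t → Unique (allF₃ t)
allF₃-unique zero    = [] ∷ []
allF₃-unique (suc t) = Unique.cartesianProductWith⁺ _∷_ Vecₚ.∷-injective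
  (((λ ()) ∷ (λ ()) ∷ []) ∷ ((λ ()) ∷ []) ∷ [] ∷ []) (allF₃-unique t)

allF₃-complete : ∀ {t} (us : Vec F₃ t) → us ∈ allF₃ t
allF₃-complete []       = here refl
allF₃-complete (u ∷ us) = ∈-cartesianProductWith⁺ _∷_ (member u) (allF₃-complete us)
  where
  member : ∀ u → u ∈ 0₃ ∷ 1₃ ∷ 2₃ ∷ []
  member 0₃ = here refl
  member 1₃ = there (here refl)
  member 2₃ = there (there (here refl))

length-allF₃ : ∀ t → length (allF₃ t) ≡ 3 ^ t
length-allF₃ zero    = refl
length-allF₃ (suc t) = trans (length-cartesianProductWith _∷_ (0₃ ∷ 1₃ ∷ 2₃ ∷ []) (allF₃ t)) (cong (3 ℕ.*_) (length-allF₃ t))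

all?-sound : ∀ {A : Set} (p : A → Bool) xs → all? p xs ≡ true → ∀ {x} → x ∈ xs → p x ≡ true
all?-sound p (x ∷ xs) eq x∈ with p x in px
all?-sound p (x ∷ xs) eq (here refl) | true = px
all?-sound p (x ∷ xs) eq (there x∈)  | true = all?-sound p xs eq x∈

module _ {A B : Set} {add-A : Additive A} {add-B : Additive B} {h : A → B} (hom : Hom add-A add-B h)
  {zero-A? : A → Bool} {zero-B? : B → Bool} (zero-homo : ∀ x → zero-B? (h x) ≡ zero-A? x) where

  allZero-homo : ∀ {r} (S : Vec A r) → allZero add-B zero-B? (map h S) ≡ allZero add-A zero-A? S
  allZero-homo []      = refl
  allZero-homo (x ∷ S) = cong₂ _∧_ (zero-homo x) (allZero-homo S)

  -- A homomorphism that preserves and reflects zero leaves every count unchanged; this lets counts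
  -- in the field be evaluated in coordinates.
  count-homo : ∀ {r} (t : Trie r) S → count add-B zero-B? t (map h S) ≡ count add-A zero-A? t S
  count-homo leaf         S = cong (if_then 1 else 0) (allZero-homo S)
  count-homo none         S = refl
  count-homo (take c t u) S = cong₂ ℕ._+_
    (trans (cong (count add-B zero-B? t) (sym (Hom.eliminate-homo hom c S))) (count-homo t (Additive.eliminate add-A c S)))
    (count-homo u S)

hits⇒count≢0 : ∀ {A : Set} (add-A : Additive A) zero? {r} (t : Trie r) S → hits add-A zero? t S ≡ true → count add-A zero? t S ≢ 0
hits⇒count≢0 add-A zero? leaf         S hit eq with allZero add-A zero? S
hits⇒count≢0 add-A zero? leaf         S hit () | true
hits⇒count≢0 add-A zero? (take c t u) S hit eq with hits add-A zero? t (Additive.eliminate add-A c S) in hit-t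
... | true  = hits⇒count≢0 add-A zero? t _ hit-t (ℕₚ.m+n≡0⇒m≡0 _ eq)
... | false = hits⇒count≢0 add-A zero? u S hit (ℕₚ.m+n≡0⇒n≡0 (count add-A zero? t (Additive.eliminate add-A c S)) eq)

module Coordinates {m : ℕ} (F : GF m) where

  open GF F
  open FieldProperties F
  open Counting F
  open Additive additive using (act; zeros)

  dot : ∀ {t} → Vec Carrier t → Vec F₃ t → Carrier
  dot []      []       = 0#
  dot (x ∷ ω) (u ∷ us) = act u x + dot ω us

  dot-zeros : ∀ {t} (ω : Vec Carrier t) → dot ω (replicate t 0₃) ≡ 0#
  dot-zeros []      = refl
  dot-zeros (x ∷ ω) = trans (+-identityˡ _) (dot-zeros ω)

  dot-hom : ∀ {t} (ω : Vec Carrier t) → Hom (additive-Vec t) additive (dot ω)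
  dot-hom ω = record { plus-homo = plus-homo ω ; negate-homo = negate-homo ω ; nil-homo = dot-zeros ω }
    where
    plus-homo : ∀ {t} (ω : Vec Carrier t) us vs → dot ω (zipWith add us vs) ≡ dot ω us + dot ω vs
    plus-homo []      []       []       = sym (+-identityˡ 0#)
    plus-homo (x ∷ ω) (u ∷ us) (v ∷ vs) = trans (cong₂ _+_ (act-add u v x) (plus-homo ω us vs)) (+-interchange _ _ _ _)
    negate-homo : ∀ {t} (ω : Vec Carrier t) us → dot ω (map neg us) ≡ - dot ω us
    negate-homo []      []       = sym -0#≈0#
    negate-homo (x ∷ ω) (u ∷ us) = trans (cong₂ _+_ (act-neg u x) (negate-homo ω us)) (-‿+-comm _ _)

  -- Wrapped in a record so that unification can recover ω from the type.
  record Independent {t} (ω : Vec Carrier t) : Set where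
    constructor independent
    field
      trivial : ∀ us → dot ω us ≡ 0# → us ≡ replicate t 0₃

  open Independent public

  span : ∀ {t} → Vec Carrier t → List Carrier
  span {t} ω = List.map (dot ω) (allF₃ t)

  dot∈span : ∀ {t} (ω : Vec Carrier t) us → dot ω us ∈ span ω
  dot∈span ω us = ∈-map⁺ (dot ω) (allF₃-complete us)

  length-span : ∀ {t} (ω : Vec Carrier t) → length (span ω) ≡ 3 ^ t
  length-span {t} ω = trans (length-map (dot ω) (allF₃ t)) (length-allF₃ t)

  _∈span?_ : ∀ {t} x (ω : Vec Carrier t) → Dec (x ∈ span ω)
  x ∈span? ω = Any.any? (x ≟_) (span ω)

  dot-injective : ∀ {t} {ω : Vec Carrier t} → Independent ω → ∀ us vs → dot ω us ≡ dot ω vs → us ≡ vs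
  dot-injective {ω = ω} indep us vs eq = cancel us vs (trivial indep (zipWith add us (map neg vs)) (begin
    dot ω (zipWith add us (map neg vs))     ≡⟨ Hom.plus-homo (dot-hom ω) us _ ⟩
    dot ω us + dot ω (map neg vs)           ≡⟨ cong₂ _+_ eq (Hom.negate-homo (dot-hom ω) vs) ⟩
    dot ω vs + - dot ω vs                   ≡⟨ -‿inverseʳ _ ⟩
    0#                                      ∎))
    where
    open ≡-Reasoning
    add-neg : ∀ u v → add u (neg v) ≡ 0₃ → u ≡ v
    add-neg 0₃ 0₃ _ = refl
    add-neg 1₃ 1₃ _ = refl
    add-neg 2₃ 2₃ _ = refl
    cancel : ∀ {t} (us vs : Vec F₃ t) → zipWith add us (map neg vs) ≡ replicate t 0₃ → us ≡ vs
    cancel []       []       _  = refl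
    cancel (u ∷ us) (v ∷ vs) eq = cong₂ _∷_ (add-neg u v (Vecₚ.∷-injectiveˡ eq)) (cancel us vs (Vecₚ.∷-injectiveʳ eq))

  -- The 3^t combinations are distinct elements of a field with 3^m elements.
  independent⇒≤ : ∀ {t} {ω : Vec Carrier t} → Independent ω → t ≤ m
  independent⇒≤ {t} {ω} indep = ℕₚ.≮⇒≥ λ m<t → ℕₚ.<⇒≱ (ℕₚ.^-monoʳ-< 3 (s≤s (s≤s z≤n)) m<t)
    (subst₂ _≤_ (length-allF₃ t) length-elements
      (injection⇒length≤ (allF₃-unique t) (dot ω) (λ _ → complete elements-listing tt)
        λ {us} {vs} _ _ → dot-injective indep us vs))

  extend : ∀ {t} {ω : Vec Carrier t} {x} → Independent ω → x ∉ span ω → Independent (x ∷ ω)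
  extend {ω = ω} {x} indep x∉ = independent go
    where
    go : ∀ us → dot (x ∷ ω) us ≡ 0# → us ≡ replicate _ 0₃
    go (0₃ ∷ us) eq = cong (0₃ ∷_) (trivial indep us (trans (sym (+-identityˡ _)) eq))
    go (1₃ ∷ us) eq = contradiction (subst (_∈ span ω) x≡ (dot∈span ω (map neg us))) x∉
      where
      x≡ : dot ω (map neg us) ≡ x
      x≡ = +-cancelʳ (dot ω us) _ _ (trans (cong (_+ dot ω us) (Hom.negate-homo (dot-hom ω) us))
        (trans (-‿inverseˡ _) (sym eq)))
    go (2₃ ∷ us) eq = contradiction (subst (_∈ span ω) x≡ (dot∈span ω us)) x∉
      where
      x≡ : dot ω us ≡ x
      x≡ = +-cancelˡ (- x) _ _ (trans eq (sym (-‿inverseˡ x)))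

  -- Fewer than m elements span fewer than 3^m, so a family that is still too short has an element
  -- outside its span.
  independentFamily : ∀ t → t ≤ m → ∃ λ (ω : Vec Carrier t) → Independent ω
  independentFamily zero    _   = [] , independent λ { [] _ → refl }
  independentFamily (suc t) t<m with ω , indep ← independentFamily t (ℕₚ.<⇒≤ t<m)
    with Any.any? (λ x → ¬? (x ∈span? ω)) elements
  ... | yes outside = let x , x∉ = Any.satisfied outside in x ∷ ω , extend indep x∉
  ... | no  none-outside = contradiction
    (subst₂ _≤_ length-elements (length-span ω)
      (injection⇒length≤ (unique elements-listing) id spanned λ _ _ → id))
    (ℕₚ.<⇒≱ (ℕₚ.^-monoʳ-< 3 (s≤s (s≤s z≤n)) t<m))
    where
    spanned : ∀ {x} → x ∈ elements → x ∈ span ω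
    spanned {x} x∈ with x ∈span? ω
    ... | yes x∈span = x∈span
    ... | no  x∉span = contradiction (Any.map (λ { refl → x∉span }) x∈) none-outside

  at : ∀ {r t} → Vec Carrier t → Vec (Vec F₃ t) r → Vec Carrier r
  at ω = map (dot ω)

  at-padded : ∀ {r t} x (ω : Vec Carrier t) (S : Vec (Vec F₃ t) r) → at (x ∷ ω) (map (0₃ ∷_) S) ≡ at ω S
  at-padded x ω []       = refl
  at-padded x ω (us ∷ S) = cong₂ _∷_ (+-identityˡ _) (at-padded x ω S)

  -- The basis is chosen greedily among the coordinates of s, so the coordinates
  -- with respect to it are in echelon form.
  normalForm : ∀ {r} (s : Vec Carrier r) → ∃ λ t → ∃ λ S → ∃ λ (ω : Vec Carrier t) →
    (t , S) ∈ normalForms m r × Independent ω × at ω S ≡ s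
  normalForm []      = 0 , [] , [] , here refl , independent (λ { [] _ → refl }) , refl
  normalForm {suc r} (x ∷ s) with t , S , ω , S∈ , indep , refl ← normalForm s with x ∈span? ω
  ... | yes x∈ with us , _ , refl ← ∈-map⁻ (dot ω) x∈ =
    t , us ∷ S , ω ,
    ∈-concatMap⁺ (extensions m) (Any.map (λ { refl → ∈-++⁺ˡ (∈-map⁺ (λ us → t , us ∷ S) (allF₃-complete us)) }) S∈) ,
    indep , refl
  ... | no  x∉ =
    suc t , (1₃ ∷ replicate t 0₃) ∷ map (0₃ ∷_) S , x ∷ ω ,
    ∈-concatMap⁺ (extensions m) (Any.map (λ { refl → ∈-++⁺ʳ _ new∈ }) S∈) ,
    indep′ ,
    cong₂ _∷_ (trans (cong (x +_) (dot-zeros ω)) (+-identityʳ x)) (at-padded x ω S)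
    where
    indep′ : Independent (x ∷ ω)
    indep′ = extend indep x∉
    -- `extensions` enlarges the basis only for t < m; independence of the enlarged family supplies
    -- this bound.
    new∈ : (suc t , (1₃ ∷ replicate t 0₃) ∷ map (0₃ ∷_) S) ∈
           (if t ℕ.<ᵇ m then (suc t , (1₃ ∷ replicate t 0₃) ∷ map (0₃ ∷_) S) ∷ [] else [])
    new∈ with t ℕ.<ᵇ m | ℕₚ.<⇒<ᵇ {t} {m} (independent⇒≤ indep′)
    ... | true | _ = here refl

  isZero#-dot : ∀ {t} {ω : Vec Carrier t} → Independent ω → ∀ us → isZero# (dot ω us) ≡ isZero us
  isZero#-dot {t} {ω} indep us with dot ω us ≟ 0#
  ... | yes eq = sym (trans (cong isZero (trivial indep us eq)) (isZero-zeros t))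
  ... | no  ≢0 with isZero us in eq
  ...   | true  = contradiction (trans (cong (dot ω) (isZero-true us eq)) (dot-zeros ω)) ≢0
  ...   | false = refl

  -- `solutions-minimal` reaches only the least weight, while refuting UPWS also takes the count one
  -- above it.
  solutions-exact : ∀ {r n t} {ω : Vec Carrier t} → Independent ω → (cols : Vec (Vec F₃ r) n) (S : Vec (Vec F₃ t) r) →
    ∀ j → solutions cols (at ω S) j ≡ exact order cols S j
  solutions-exact         {ω = ω} indep cols       S zero    = trans (solutions-0 cols (at ω S))
    (cong (if_then 1 else 0) (allZero-homo (dot-hom ω) (isZero#-dot indep) S))
  solutions-exact         {ω = ω} indep []         S (suc j) = solutions-[] (at ω S) j
  solutions-exact {zero}  {ω = ω} indep (c ∷ cols) S (suc j) with [] ← c = trans (solutions-split [] cols (at ω S) (suc j))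
    (cong₂ ℕ._+_ (solutions-exact indep cols S (suc j))
      (trans (usingHead-zero [] cols (at ω S) j refl) (cong ((order ∸ 1) ℕ.*_) (solutions-exact indep cols S j))))
  solutions-exact {suc r} {ω = ω} indep (c ∷ cols) S (suc j) =
    trans (solutions-split c cols (at ω S) (suc j)) (cong₂ ℕ._+_ (solutions-exact indep cols S (suc j)) head-part)
    where
    head-part : usingHead (c ∷ cols) (at ω S) (suc j) ≡
      (if isZero c then (order ∸ 1) ℕ.* exact order cols S j
       else exact order (contract c cols) (Additive.eliminate (additive-Vec _) c S) j ∸ exact order cols S j)
    head-part with isZero c in eq
    ... | true  = trans (usingHead-zero c cols (at ω S) j eq) (cong ((order ∸ 1) ℕ.*_) (solutions-exact indep cols S j))
    ... | false = begin
      usingHead (c ∷ cols) s (suc j)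
        ≡⟨ ℕₚ.m+n∸m≡n (solutions cols s j) _ ⟨
      (solutions cols s j ℕ.+ usingHead (c ∷ cols) s (suc j)) ∸ solutions cols s j
        ≡⟨ cong (_∸ solutions cols s j) (usingHead-pivot c cols s j eq) ⟨
      solutions (contract c cols) (Additive.eliminate additive c s) j ∸ solutions cols s j
        ≡⟨ cong (λ s′ → solutions (contract c cols) s′ j ∸ solutions cols s j) (Hom.eliminate-homo (dot-hom ω) c S) ⟨
      solutions (contract c cols) (at ω (Additive.eliminate (additive-Vec _) c S)) j ∸ solutions cols s j
        ≡⟨ cong₂ _∸_ (solutions-exact indep (contract c cols) _ j) (solutions-exact indep cols S j) ⟩
      exact order (contract c cols) (Additive.eliminate (additive-Vec _) c S) j ∸ exact order cols S j ∎
      where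
      open ≡-Reasoning
      s = at ω S

-- Filters, and the rational equations behind UPWS

map-filter : ∀ {A B : Set} {P : A → Set} {Q : B → Set} (f : A → B) (P? : Decidable P) (Q? : Decidable Q) →
  (∀ {x} → P x → Q (f x)) → (∀ {x} → Q (f x) → P x) → ∀ xs →
  List.map f (filter P? xs) ≡ filter Q? (List.map f xs)
map-filter f P? Q? to from []       = refl
map-filter f P? Q? to from (x ∷ xs) with P? x | Q? (f x)
... | yes p | yes q = cong (f x ∷_) (map-filter f P? Q? to from xs)
... | yes p | no ¬q = contradiction (to p) ¬q
... | no ¬p | yes q = contradiction (from q) ¬p
... | no ¬p | no ¬q = map-filter f P? Q? to from xs

filter≢[]⇒Any : ∀ {A : Set} {P : A → Set} (P? : Decidable P) xs → length (filter P? xs) ≢ 0 → Any P xs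
filter≢[]⇒Any P? xs ≢0 with Any.any? P? xs
... | yes any = any
... | no  ¬any = contradiction (cong length (filter-none P? (¬Any⇒All¬ xs ¬any))) ≢0

natural : ℕ → ℚ
natural n = ℤ.+ n ℚ./ 1

-- With R = k + 1, a vector at distance at least R - 1 from the code leaves only the last two
-- coefficients in the UPWS sum.
sum-last-two : ∀ k (β : Fin (2 ℕ.+ k) → ℚ) (b : Fin (2 ℕ.+ k) → ℕ) → (∀ j → toℕ j < k → b j ≡ 0) →
  List.foldr ℚ._+_ 0ℚ (List.map (λ j → β j ℚ.* natural (b j)) (List.allFin (2 ℕ.+ k))) ≡
  β (inject₁ (fromℕ k)) ℚ.* natural (b (inject₁ (fromℕ k))) ℚ.+ β (fromℕ (suc k)) ℚ.* natural (b (fromℕ (suc k)))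
sum-last-two zero    β b vanish = cong (β zero ℚ.* natural (b zero) ℚ.+_) (ℚₚ.+-identityʳ _)
sum-last-two (suc k) β b vanish = begin
  term zero ℚ.+ total (List.map term (List.tabulate {n = 2 ℕ.+ k} suc))
    ≡⟨ cong₂ (λ x ys → β zero ℚ.* natural x ℚ.+ total ys) (vanish zero (s≤s z≤n))
         (trans (map-tabulate {n = 2 ℕ.+ k} suc term) (sym (map-tabulate {n = 2 ℕ.+ k} id (term ∘ suc)))) ⟩
  β zero ℚ.* 0ℚ ℚ.+ total (List.map (term ∘ suc) (List.allFin (2 ℕ.+ k)))
    ≡⟨ trans (cong (ℚ._+ total (List.map (term ∘ suc) (List.allFin (2 ℕ.+ k)))) (ℚₚ.*-zeroʳ (β zero))) (ℚₚ.+-identityˡ _) ⟩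
  total (List.map (term ∘ suc) (List.allFin (2 ℕ.+ k)))
    ≡⟨ sum-last-two k (β ∘ suc) (b ∘ suc) (λ j j<k → vanish (suc j) (s≤s j<k)) ⟩
  term (inject₁ (fromℕ (suc k))) ℚ.+ term (fromℕ (2 ℕ.+ k)) ∎
  where
  open ≡-Reasoning
  total : List ℚ → ℚ
  total = List.foldr ℚ._+_ 0ℚ
  term : Fin (3 ℕ.+ k) → ℚ
  term j = β j ℚ.* natural (b j)

-- Three equations in x and y are compatible only if the determinant with rows (0, l, 1), (a, b, 1),
-- (c, d, 1) vanishes; its expansion is written without subtraction.
dependent : ∀ l a b c d x y → x ℚ.* 0ℚ ℚ.+ y ℚ.* l ≡ 1ℚ → x ℚ.* a ℚ.+ y ℚ.* b ≡ 1ℚ → x ℚ.* c ℚ.+ y ℚ.* d ≡ 1ℚ →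
  c ℚ.* l ℚ.+ a ℚ.* d ≡ a ℚ.* l ℚ.+ c ℚ.* b
dependent l a b c d x y e₀ e₁ e₂ = begin
  c ℚ.* l ℚ.+ a ℚ.* d                                                                              ≡⟨ scaled (c ℚ.* l) (a ℚ.* d) e₁ e₀ ⟨
  c ℚ.* l ℚ.* (x ℚ.* a ℚ.+ y ℚ.* b) ℚ.+ a ℚ.* d ℚ.* (x ℚ.* 0ℚ ℚ.+ y ℚ.* l)                         ≡⟨ identity ⟩
  a ℚ.* l ℚ.* (x ℚ.* c ℚ.+ y ℚ.* d) ℚ.+ c ℚ.* b ℚ.* (x ℚ.* 0ℚ ℚ.+ y ℚ.* l)                         ≡⟨ scaled (a ℚ.* l) (c ℚ.* b) e₂ e₀ ⟩
  a ℚ.* l ℚ.+ c ℚ.* b                                                                              ∎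
  where
  open ≡-Reasoning
  scaled : ∀ p q {u v} → u ≡ 1ℚ → v ≡ 1ℚ → p ℚ.* u ℚ.+ q ℚ.* v ≡ p ℚ.+ q
  scaled p q refl refl = cong₂ ℚ._+_ (ℚₚ.*-identityʳ p) (ℚₚ.*-identityʳ q)
  identity : c ℚ.* l ℚ.* (x ℚ.* a ℚ.+ y ℚ.* b) ℚ.+ a ℚ.* d ℚ.* (x ℚ.* 0ℚ ℚ.+ y ℚ.* l) ≡
             a ℚ.* l ℚ.* (x ℚ.* c ℚ.+ y ℚ.* d) ℚ.+ c ℚ.* b ℚ.* (x ℚ.* 0ℚ ℚ.+ y ℚ.* l)
  identity = solve 7 (λ l a b c d x y →
    c :* l :* (x :* a :+ y :* b) :+ a :* d :* (x :* con 0ℚ :+ y :* l) :=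
    a :* l :* (x :* c :+ y :* d) :+ c :* b :* (x :* con 0ℚ :+ y :* l)) refl l a b c d x y

-- From syndromes to codes

module Codes {m : ℕ} (F : GF m) where

  open GF F
  open FieldProperties F
  open Counting F
  open Coverage F
  open Coordinates F
  open Additive additive using (act; scale; zeros; comb)

  private
    same-test : ∀ x y → does (x ≟ y) ≡ does ((x + - y) ≟ 0#)
    same-test x y with x ≟ y | (x + - y) ≟ 0#
    ... | yes _   | yes _  = refl
    ... | no  _   | no  _  = refl
    ... | yes x≡y | no  ≢0 = contradiction (trans (cong (_+ - y) x≡y) (-‿inverseʳ _)) ≢0
    ... | no  x≢y | yes ≡0 = contradiction (+-cancelʳ (- y) _ _ (trans ≡0 (sym (-‿inverseʳ y)))) x≢y

    dist-tail : ∀ {n} (x y : Fin (suc n) → Carrier) →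
      length (filter (λ j → ¬? (x j ≟ y j)) (List.tabulate {n = n} suc)) ≡ dist (x ∘ suc) (y ∘ suc)
    dist-tail {n} x y = begin
      length (filter (λ j → ¬? (x j ≟ y j)) (List.tabulate {n = n} suc))
        ≡⟨ cong (λ js → length (filter (λ j → ¬? (x j ≟ y j)) js)) (map-tabulate {n = n} id suc) ⟨
      length (filter (λ j → ¬? (x j ≟ y j)) (List.map suc (List.allFin n)))
        ≡⟨ cong length (map-filter suc (λ j → ¬? (x (suc j) ≟ y (suc j))) (λ j → ¬? (x j ≟ y j)) id id (List.allFin n)) ⟨
      length (List.map suc (filter (λ j → ¬? (x (suc j) ≟ y (suc j))) (List.allFin n)))
        ≡⟨ length-map {B = Fin (suc n)} suc (filter (λ j → ¬? (x (suc j) ≟ y (suc j))) (List.allFin n)) ⟩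
      dist (x ∘ suc) (y ∘ suc) ∎
      where open ≡-Reasoning

  dist≡weight : ∀ {n} (x y : Fin n → Carrier) → dist x y ≡ weight (tabulate x ⊟ tabulate y)
  dist≡weight {zero}  x y = refl
  dist≡weight {suc n} x y with does (x zero ≟ y zero) | does ((x zero + - y zero) ≟ 0#) | same-test (x zero) (y zero)
  ... | true  | true  | refl = trans (dist-tail x y) (dist≡weight (x ∘ suc) (y ∘ suc))
  ... | false | false | refl = cong suc (trans (dist-tail x y) (dist≡weight (x ∘ suc) (y ∘ suc)))

  words : ∀ {n} → List (Fin n → Carrier) → List (Vec Carrier n)
  words = List.map tabulate

  tabulate-zeroVec : ∀ n → tabulate (zeroVec {n}) ≡ zeros
  tabulate-zeroVec zero    = refl
  tabulate-zeroVec (suc n) = cong (0# ∷_) (tabulate-zeroVec n)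

  wt≡weight : ∀ {n} (x : Fin n → Carrier) → wt x ≡ weight (tabulate x)
  wt≡weight {n} x = trans (dist≡weight x zeroVec) (cong weight (begin
    tabulate x ⊟ tabulate zeroVec       ≡⟨ cong (tabulate x ⊟_) (tabulate-zeroVec n) ⟩
    tabulate x ⊟ zeros                  ≡⟨ cong (_⊟ zeros) (⊞-identityʳ (tabulate x)) ⟨
    (tabulate x ⊞ zeros) ⊟ zeros        ≡⟨ ⊞-⊟ (tabulate x) zeros ⟩
    tabulate x                          ∎))
    where open ≡-Reasoning

  solution⇒solutions≢0 : ∀ {r n} (cols : Vec (Vec F₃ r) n) s j {e} → Solution cols s j e → solutions cols s j ≢ 0
  solution⇒solutions≢0 cols s j sol eq = contradiction
    (filter-some (solution? cols s j) (Any.map (λ { refl → sol }) (vecs-complete _))) (subst (0 ℕ.≮_) (sym eq) λ ())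

  solutions≢0⇒solution : ∀ {r n} (cols : Vec (Vec F₃ r) n) s j → solutions cols s j ≢ 0 → ∃ (Solution cols s j)
  solutions≢0⇒solution {n = n} cols s j ≢0 = Any.satisfied (filter≢[]⇒Any (solution? cols s j) (vecs n) ≢0)

  -- The only link to a concrete code; once it is established, lifted codes and duals are treated
  -- alike.
  CheckedBy : ∀ {r n} → Vec (Vec F₃ r) n → List (Fin n → Carrier) → Set
  CheckedBy H C = Listing (λ e → comb H e ≡ zeros) (words C)

  module Code {r n} (H : Vec (Vec F₃ r) n) (C : List (Fin n → Carrier)) (checked : CheckedBy H C) where

    syndrome : (Fin n → Carrier) → Vec Carrier r
    syndrome v = comb H (tabulate v)

    -- The involution c ↦ v - c exchanges the codewords at distance j from v with the solutions of
    -- weight j.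
    B≡solutions : ∀ j v → B j v C ≡ solutions H (syndrome v) j
    B≡solutions j v = begin
      B j v C
        ≡⟨ length-map tabulate (filter (λ c → dist v c ℕ.≟ j) C) ⟨
      length (List.map tabulate (filter (λ c → dist v c ℕ.≟ j) C))
        ≡⟨ cong length (map-filter tabulate (λ c → dist v c ℕ.≟ j) (λ w → weight (tabulate v ⊟ w) ℕ.≟ j)
             (λ {c} → trans (sym (dist≡weight v c))) (λ {c} → trans (dist≡weight v c)) C) ⟩
      length (filter (λ w → weight (tabulate v ⊟ w) ℕ.≟ j) (words C))
        ≡⟨ bijection⇒length≡ (filter-listing (λ w → weight (tabulate v ⊟ w) ℕ.≟ j) checked)
             (filter-vecs (solution? H (syndrome v) j)) (tabulate v ⊟_) (tabulate v ⊟_)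
             (λ {w} (w∈ , wt) → trans (comb-⊟ H _ w) (trans (cong (syndrome v ⊟_) w∈) (⊟-zeros _)) , wt)
             (λ {e} (sol , wt) → trans (comb-⊟ H _ e) (trans (cong (syndrome v ⊟_) sol) (x⊟x≡0 _)) ,
                                 trans (cong weight (x⊟[x⊟y]≡y (tabulate v) e)) wt)
             (λ {w} _ → x⊟[x⊟y]≡y (tabulate v) w) (λ {e} _ → x⊟[x⊟y]≡y (tabulate v) e) ⟩
      solutions H (syndrome v) j ∎
      where
      open ≡-Reasoning
      ⊟-zeros : ∀ {r} (x : Vec Carrier r) → x ⊟ zeros ≡ x
      ⊟-zeros x = trans (cong (_⊟ zeros) (sym (⊞-identityʳ x))) (⊞-⊟ x zeros)

    solutions≢0⇒near : ∀ v i → solutions H (syndrome v) i ≢ 0 → Any (λ c → dist v c ≡ i) C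
    solutions≢0⇒near v i ≢0 = filter≢[]⇒Any (λ c → dist v c ℕ.≟ i) C (≢0 ∘ trans (sym (B≡solutions i v)))

    no-solutions⇒far : ∀ v R → (∀ {i} → i < R → solutions H (syndrome v) i ≡ 0) → All (λ c → R ≤ dist v c) C
    no-solutions⇒far v R absent = All.tabulate λ {c} c∈ → ℕₚ.≮⇒≥ λ d<R →
      ℕₚ.<⇒≢ (filter-some (λ c′ → dist v c′ ℕ.≟ dist v c) (Any.map (λ { refl → refl }) c∈))
        (sym (trans (B≡solutions (dist v c) v) (absent d<R)))

    far⇒no-solutions : ∀ v R → All (λ c → R ≤ dist v c) C → ∀ {i} → i < R → solutions H (syndrome v) i ≡ 0
    far⇒no-solutions v R far {i} i<R = trans (sym (B≡solutions i v))
      (cong length (filter-none (λ c → dist v c ℕ.≟ i) (All.map (λ R≤d d≡i → ℕₚ.<⇒≢ (ℕₚ.<-≤-trans i<R R≤d) (sym d≡i)) far)))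

    hasDimension : ∀ {k} → nullity H ≡ k → HasDimension C k
    hasDimension {k} dimension = begin
      length C                ≡⟨ length-map tabulate C ⟨
      length (words C)        ≡⟨ bijection⇒length≡ checked (filter-vecs (kernel? H)) id id id id (λ _ → refl) (λ _ → refl) ⟩
      length (kernel H)       ≡⟨ length-kernel H ⟩
      order ^ nullity H       ≡⟨ cong (order ^_) dimension ⟩
      order ^ k               ∎
      where open ≡-Reasoning

    -- The form `suc l` says that the columns of H contain a basis. Hence every vector is a
    -- syndrome, and l + 1 is the multiplicity whenever the covering radius equals r.
    module Covering {l} (basis-count : bases H ≡ suc l) where

      spanning : bases H ≢ 0
      spanning eq = contradiction (trans (sym basis-count) eq) λ ()

      syndrome-surjective : ∀ s → ∃ λ v → syndrome v ≡ s
      syndrome-surjective s =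
        let i , _ , ≢0 = count≢0⇒near H s r (spanning ∘ trans (sym (count-bases H s)))
            e , sol , _ = solutions≢0⇒solution H s i ≢0
        in lookup e , trans (cong (comb H) (Vecₚ.tabulate∘lookup e)) sol

      near : ∀ R s v → syndrome v ≡ s → count additive isZero# (trie H R) s ≢ 0 → Any (λ c → dist v c ≤ R) C
      near R s v refl ≢0 = let i , i≤R , ≢0′ = count≢0⇒near H s R ≢0
        in Any.map (λ d≡i → subst (_≤ R) (sym d≡i) i≤R) (solutions≢0⇒near v i ≢0′)

      farther⇒no-solutions : ∀ {t} {ω : Vec Carrier t} → Independent ω → ∀ S R → farther H S R ≡ true →
        ∀ {i} → i < R → solutions H (at ω S) i ≡ 0
      farther⇒no-solutions {t} {ω} indep S (suc R) eq {i} i<R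
        with count (additive-Vec t) isZero (trie H R) S in zero-count
      ... | zero with ℕₚ.m≤n⇒m<n∨m≡n (ℕₚ.≤-pred i<R)
      ...   | inj₁ i<R′ = farther⇒no-solutions indep S R eq i<R′
      ...   | inj₂ refl = trans (solutions-minimal H (at ω S) R (farther⇒no-solutions indep S R eq))
        (trans (count-homo (dot-hom ω) (isZero#-dot indep) (trie H R) S) zero-count)

      -- Any t independent field elements realise the ternary matrix S as a syndrome, so one test
      -- over 𝔽₃ serves all m ≥ t.
      deep-hole : ∀ {t} → t ≤ m → (S : Vec (Vec F₃ t) r) → ∀ R → farther H S R ≡ true →
        Σ (Fin n → Carrier) λ v → All (λ c → R ≤ dist v c) C
      deep-hole {t} t≤m S R eq =
        let ω , indep = independentFamily t t≤m
            v , v↦s = syndrome-surjective (at ω S)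
        in v , no-solutions⇒far v R λ i<R → trans (cong (λ s → solutions H s _) v↦s) (farther⇒no-solutions indep S R eq i<R)

      -- When R is the redundancy every vector at distance R sees one codeword
      -- for each basis among the columns of H.
      apmcf-full : ∀ {t} → t ≤ m → (S : Vec (Vec F₃ t) r) → farther H S r ≡ true → APMCF C r (suc l)
      apmcf-full t≤m S eq = (covered , deep-hole t≤m S r eq) , λ v (_ , far) → begin
        B r v C                                                    ≡⟨ B≡solutions r v ⟩
        solutions H (syndrome v) r                                 ≡⟨ solutions-minimal H _ r (far⇒no-solutions v r far) ⟩
        count additive isZero# (trie H r) (syndrome v)             ≡⟨ count-bases H _ ⟩
        bases H                                                    ≡⟨ basis-count ⟩
        suc l                                                      ∎
        where
        open ≡-Reasoning
        covered : ∀ v → Any (λ c → dist v c ≤ r) C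
        covered v = near r _ v refl (spanning ∘ trans (sym (count-bases H _)))

      -- One dichotomy for syndromes gives both halves: the radius is at most R + 1 because `suc λ′`
      -- is not 0, and a vector at distance R + 1 falls under the second alternative, which fixes
      -- its multiplicity.
      apmcf-checked : ∀ R λ′ → coversAll H m R (suc λ′) ≡ true →
        ∀ {t} → t ≤ m → (S : Vec (Vec F₃ t) r) → farther H S (suc R) ≡ true → APMCF C (suc R) (suc λ′)
      apmcf-checked R λ′ checked-all t≤m S₀ eq = (covered , deep-hole t≤m S₀ (suc R) eq) , regular
        where
        open ≡-Reasoning

        cases : ∀ s → count additive isZero# (trie H R) s ≢ 0 ⊎ count additive isZero# (trie H (suc R)) s ≡ suc λ′
        cases s with t , S , ω , S∈ , indep , refl ← normalForm s
          with all?-sound (covers (trie H R) (trie H (suc R)) (suc λ′)) (normalForms m r) checked-all S∈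
        ... | ok with hits (additive-Vec t) isZero (trie H R) S in hit
        ...   | true  = inj₁ (hits⇒count≢0 (additive-Vec t) isZero (trie H R) S hit ∘ trans (sym (transfer (trie H R))))
          where transfer = λ (t : Trie r) → count-homo (dot-hom ω) (isZero#-dot indep) t S
        ...   | false = inj₂ (trans (count-homo (dot-hom ω) (isZero#-dot indep) (trie H (suc R)) S)
          (ℕₚ.≡ᵇ⇒≡ _ _ (subst T (sym ok) tt)))

        covered : ∀ v → Any (λ c → dist v c ≤ suc R) C
        covered v with cases (syndrome v)
        ... | inj₁ ≢0 = Any.map ℕₚ.m≤n⇒m≤1+n (near R _ v refl ≢0)
        ... | inj₂ eq′ = near (suc R) _ v refl λ ≡0 → contradiction (trans (sym ≡0) eq′) λ ()

        regular : ∀ v → DistToCode v C (suc R) → B (suc R) v C ≡ suc λ′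
        regular v (_ , far) with cases (syndrome v)
        ... | inj₂ eq′ = begin
          B (suc R) v C                                              ≡⟨ B≡solutions (suc R) v ⟩
          solutions H (syndrome v) (suc R)                           ≡⟨ solutions-minimal H _ (suc R) (far⇒no-solutions v (suc R) far) ⟩
          count additive isZero# (trie H (suc R)) (syndrome v)       ≡⟨ eq′ ⟩
          suc λ′                                                      ∎
        ... | inj₁ ≢0 = let i , i≤R , ≢0′ = count≢0⇒near H (syndrome v) R ≢0
          in contradiction (far⇒no-solutions v (suc R) far (s≤s i≤R)) ≢0′

      -- A coset whose weight distribution starts with 0, …, 0, a, b, the entry a
      -- being the number of vectors of weight k.
      record Profile (k a b : ℕ) : Set where
        constructor profile
        field
          {rank}   : ℕ
          rank≤m   : rank ≤ m
          coset    : Vec (Vec F₃ rank) r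
          no-light : farther H coset k ≡ true
          first    : exact order H coset k ≡ a
          second   : exact order H coset (suc k) ≡ b

      profile-equation : ∀ {k a b} → Profile k a b → ((β , _) : UPWS C (suc k)) →
        β (inject₁ (fromℕ k)) ℚ.* natural a ℚ.+ β (fromℕ (suc k)) ℚ.* natural b ≡ 1ℚ
      profile-equation {k} {a} {b} (profile rank≤m S no-light first second) (β , weighted) = begin
        β (inject₁ (fromℕ k)) ℚ.* natural a ℚ.+ β (fromℕ (suc k)) ℚ.* natural b
          ≡⟨ cong₂ (λ x y → β (inject₁ (fromℕ k)) ℚ.* natural x ℚ.+ β (fromℕ (suc k)) ℚ.* natural y)
               (trans (trans (B-exact _) (cong (exact order H S) (trans (Finₚ.toℕ-inject₁ _) (Finₚ.toℕ-fromℕ k)))) first)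
               (trans (trans (B-exact _) (cong (exact order H S) (Finₚ.toℕ-fromℕ (suc k)))) second) ⟨
        β (inject₁ (fromℕ k)) ℚ.* natural (B (toℕ (inject₁ (fromℕ k))) v C) ℚ.+
        β (fromℕ (suc k)) ℚ.* natural (B (toℕ (fromℕ (suc k))) v C)
          ≡⟨ sum-last-two k β (λ j → B (toℕ j) v C) (λ j j<k → trans (B≡solutions (toℕ j) v)
               (trans (cong (λ s → solutions H s (toℕ j)) v↦s) (farther⇒no-solutions indep S k no-light j<k))) ⟨
        sumℚ (List.map (λ j → β j ℚ.* natural (B (toℕ j) v C)) (List.allFin (2 ℕ.+ k)))
          ≡⟨ weighted v ⟩
        1ℚ ∎
        where
        open ≡-Reasoning
        ω = proj₁ (independentFamily _ rank≤m)
        indep = proj₂ (independentFamily _ rank≤m)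
        v = proj₁ (syndrome-surjective (at ω S))
        v↦s = proj₂ (syndrome-surjective (at ω S))
        B-exact : ∀ j → B j v C ≡ exact order H S j
        B-exact j = trans (B≡solutions j v) (trans (cong (λ s → solutions H s j) v↦s) (solutions-exact indep H S j))

      -- The first coset has no vector of weight k, so it alone fixes the last coefficient. The
      -- inequality says that the determinant in `dependent` does not vanish.
      not-upws : ∀ {k l₀ a b c d} → Profile k 0 l₀ → Profile k a b → Profile k c d →
        natural c ℚ.* natural l₀ ℚ.+ natural a ℚ.* natural d ≢ natural a ℚ.* natural l₀ ℚ.+ natural c ℚ.* natural b →
        ¬ UPWS C (suc k)
      not-upws {k} {l₀} {a} {b} {c} {d} P Q R ≢ upws@(β , _) = ≢ (dependent
        (natural l₀) (natural a) (natural b) (natural c) (natural d) (β (inject₁ (fromℕ k))) (β (fromℕ (suc k)))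
        (profile-equation P upws) (profile-equation Q upws) (profile-equation R upws))

    -- The bound comes from `separated`; it is attained by a ternary codeword x scaled by a nonzero
    -- field element.
    hasMinDist : 1 ≤ m → ∀ d → separated H d ≡ true → (x : Vec F₃ n) →
      Additive.comb additive-F₃ H x ≡ replicate r 0₃ → weight₃ x ≡ suc d → HasMinDist C (suc d)
    hasMinDist 1≤m d sep x x∈ x-wt = lightest , All.tabulate (λ {c} c∈ → bounded c (sound checked (∈-map⁺ tabulate c∈)))
      where
      bounded : ∀ c → comb H (tabulate c) ≡ zeros → Σ (Fin n) (λ j → c j ≢ 0#) → suc d ≤ wt c
      bounded c c∈ (j , cj≢0) = ℕₚ.≮⇒≥ λ wt<d → heavy (weight (tabulate c)) refl (subst (_< suc d) (wt≡weight c) wt<d)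
        where
        heavy : ∀ w → weight (tabulate c) ≡ w → w < suc d → ⊥
        heavy zero    eq _         = cj≢0 (begin
          c j                          ≡⟨ Vecₚ.lookup∘tabulate c j ⟨
          lookup (tabulate c) j        ≡⟨ cong (λ v → lookup v j) (weight≡0⇒zeros (tabulate c) eq) ⟩
          lookup zeros j               ≡⟨ Vecₚ.lookup-replicate j 0# ⟩
          0#                           ∎)
          where open ≡-Reasoning
        heavy (suc w) eq (s≤s w<d) = solution⇒solutions≢0 H zeros (suc w) (c∈ , eq) (separated⇒no-light H d sep w<d)

      -- `GF` does not postulate 1 ≠ 0, so the nonzero element comes from an independent family,
      -- which is where `1 ≤ m` enters.
      unit-element : ∃ λ a → a ≢ 0#
      unit-element with a ∷ [] , indep ← independentFamily 1 1≤m = a , λ a≡0 →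
        contradiction (trivial indep (1₃ ∷ []) (trans (+-identityʳ a) a≡0)) λ ()

      a : Carrier
      a = proj₁ unit-element

      a≢0 : a ≢ 0#
      a≢0 = proj₂ unit-element

      -a≢0 : - a ≢ 0#
      -a≢0 -a≡0 = a≢0 (trans (sym (-‿involutive a)) (trans (cong -_ -a≡0) -0#≈0#))

      weight-scale : ∀ {n} (x : Vec F₃ n) → weight (scale a x) ≡ weight₃ x
      weight-scale []       = refl
      weight-scale (0₃ ∷ x) = trans (weight-0∷ (scale a x)) (weight-scale x)
      weight-scale (1₃ ∷ x) = trans (weight-∷ (scale a x) a≢0) (cong suc (weight-scale x))
      weight-scale (2₃ ∷ x) = trans (weight-∷ (scale a x) -a≢0) (cong suc (weight-scale x))

      nonzero-coordinate : ∀ {n} (x : Fin n → Carrier) k → weight (tabulate x) ≡ suc k → Σ (Fin n) λ j → x j ≢ 0#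
      nonzero-coordinate {suc n} x k eq with x zero ≟ 0#
      ... | no  x₀≢0 = zero , x₀≢0
      ... | yes _    = let j , xj≢0 = nonzero-coordinate (x ∘ suc) k eq in suc j , xj≢0

      lightest : Any (λ c → (Σ (Fin n) λ j → c j ≢ 0#) × wt c ≡ suc d) C
      lightest with c , c∈ , eq ← ∈-map⁻ tabulate (complete checked (trans (sym (Hom.comb-homo (evaluation a) H x))
                                     (trans (cong (map (λ u → act u a)) x∈) (Hom.zeros-homo (evaluation a) {r}))))
        = Any.map (λ { refl → nonzero-coordinate c d c-weight , trans (wt≡weight c) c-weight }) c∈
        where
        c-weight : weight (tabulate c) ≡ suc d
        c-weight = trans (cong weight (sym eq)) (trans (weight-scale x) x-wt)

  lookup-comb : ∀ {r n} (cols : Vec (Vec F₃ r) n) (x : Fin n → Carrier) i →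
    lookup (comb cols (tabulate x)) i ≡ sumF (List.map (λ j → act (lookup (lookup cols j) i) (x j)) (List.allFin n))
  lookup-comb []         x i = Vecₚ.lookup-replicate i 0#
  lookup-comb {n = suc n} (c ∷ cols) x i = begin
    lookup (scale (x zero) c ⊞ comb cols (tabulate (x ∘ suc))) i
      ≡⟨ Vecₚ.lookup-zipWith _+_ i (scale (x zero) c) _ ⟩
    lookup (scale (x zero) c) i + lookup (comb cols (tabulate (x ∘ suc))) i
      ≡⟨ cong₂ _+_ (Vecₚ.lookup-map i (λ u → act u (x zero)) c) (lookup-comb cols (x ∘ suc) i) ⟩
    term zero + sumF (List.map (term ∘ suc) (List.allFin n))
      ≡⟨ cong (λ ys → term zero + sumF ys) (trans (map-tabulate {n = n} id (term ∘ suc)) (sym (map-tabulate {n = n} suc term))) ⟩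
    term zero + sumF (List.map term (List.tabulate {n = n} suc)) ∎
    where
    open ≡-Reasoning
    term : Fin (suc n) → Carrier
    term j = act (lookup (lookup (c ∷ cols) j) i) (x j)

  act-residue : ∀ k x → act (residue k) x ≡ ι k * x
  act-residue 0                   x = sym (zeroˡ x)
  act-residue 1                   x = sym (*-identityˡ x)
  act-residue 2                   x = trans (sym (x+x≡-x x)) (trans (sym (cong₂ _+_ (*-identityˡ x) (*-identityˡ x))) (sym (distribʳ x 1# 1#)))
  act-residue (suc (suc (suc k))) x = sym (zeroˡ x)

  lookup-rows : ∀ {k n} (G : Vec (Vec ℕ n) k) i j → lookup (lookup (rows G) i) j ≡ residue (lookup (lookup G i) j)
  lookup-rows G i j = trans (cong (λ g → lookup g j) (Vecₚ.lookup-map i (map residue) G)) (Vecₚ.lookup-map j residue (lookup G i))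

  lookup-columns : ∀ {k n} (G : Vec (Vec ℕ n) k) i j → lookup (lookup (columns G) j) i ≡ residue (lookup (lookup G i) j)
  lookup-columns G i j = trans (cong (λ c → lookup c i) (Vecₚ.lookup∘tabulate _ j))
    (trans (Vecₚ.lookup-map i (λ g → lookup g j) (rows G)) (lookup-rows G i j))

  encode≡comb : ∀ {k n} (G : Vec (Vec ℕ n) k) u → tabulate (encode G u) ≡ comb (rows G) (tabulate u)
  encode≡comb {k} G u = trans (Vecₚ.tabulate-cong λ j → sym (trans (lookup-comb (rows G) u j)
      (cong sumF (map-cong (λ i → trans (cong (λ g → act g (u i)) (lookup-rows G i j))
        (trans (act-residue (lookup (lookup G i) j) (u i)) (*-comm _ _))) (List.allFin k)))))
    (Vecₚ.tabulate∘lookup _)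

  lookup-syndrome : ∀ {k n} (G : Vec (Vec ℕ n) k) (x : Fin n → Carrier) i → lookup (comb (columns G) (tabulate x)) i ≡
    sumF (List.map (λ j → ι (lookup (lookup G i) j) * x j) (List.allFin n))
  lookup-syndrome {n = n} G x i = trans (lookup-comb (columns G) x i)
    (cong sumF (map-cong (λ j → trans (cong (λ g → act g (x j)) (lookup-columns G i j)) (act-residue (lookup (lookup G i) j) (x j)))
      (List.allFin n)))

  liftedDual-checked : ∀ {k n} (G : Vec (Vec ℕ n) k) → CheckedBy (columns G) (liftedDual G)
  liftedDual-checked {k} {n} G = subst (Listing (λ e → comb (columns G) e ≡ zeros))
    (sym (map-filter tabulate (syndromeZero? G) (kernel? (columns G))
      (λ {x} zero-at → lookup≡0⇒zeros _ λ i → trans (lookup-syndrome G x i) (zero-at i))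
      (λ {x} eq i → trans (sym (lookup-syndrome G x i)) (trans (cong (λ s → lookup s i) eq) (Vecₚ.lookup-replicate i 0#)))
      (allVecs n)))
    (filter-vecs (kernel? (columns G)))
    where
    lookup≡0⇒zeros : ∀ {r} (x : Vec Carrier r) → (∀ i → lookup x i ≡ 0#) → x ≡ zeros
    lookup≡0⇒zeros []      _  = refl
    lookup≡0⇒zeros (a ∷ x) eq = cong₂ _∷_ (eq zero) (lookup≡0⇒zeros x (eq ∘ suc))

  length-vecs : ∀ n → length (vecs n) ≡ order ^ n
  length-vecs zero    = refl
  length-vecs (suc n) = trans (cong length (vecs-suc n)) (trans (length-cartesianProductWith _∷_ elements (vecs n))
    (cong₂ ℕ._*_ length-elements (length-vecs n)))

  -- Orthogonality puts the image of the encoder inside the kernel of H, and injectivity gives it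
  -- order^k elements, as many as the kernel has. So the two agree.
  lifted-checked : ∀ {k n r} (G : Vec (Vec ℕ n) k) (H : Vec (Vec F₃ r) n) →
    map (Additive.comb additive-F₃ H) (rows G) ≡ replicate k (replicate r 0₃) →
    nullity (rows G) ≡ 0 → nullity H ≡ k → CheckedBy H (lifted G)
  lifted-checked {k} {n} {r} G H orthogonal injective dimension =
    subst (Listing (λ e → comb H e ≡ zeros)) (sym words-lifted) record
      { unique   = unique-image
      ; sound    = image⊆
      ; complete = λ e∈ → unique⇒surjective _≟ᵛ_ unique-image (complete (filter-vecs (kernel? H)) ∘ image⊆)
          (ℕₚ.≤-reflexive (begin
            length (kernel H)        ≡⟨ length-kernel H ⟩
            order ^ nullity H        ≡⟨ cong (order ^_) dimension ⟩
            order ^ k                ≡⟨ length-vecs k ⟨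
            length (vecs k)          ≡⟨ length-map (comb (rows G)) (vecs k) ⟨
            length image             ∎))
          (complete (filter-vecs (kernel? H)) e∈)
      }
    where
    open ≡-Reasoning

    image : List (Vec Carrier n)
    image = List.map (comb (rows G)) (vecs k)

    words-lifted : words (lifted G) ≡ image
    words-lifted = begin
      List.map tabulate (List.map (encode G) (allVecs k))          ≡⟨ map-∘ (allVecs k) ⟨
      List.map (λ u → tabulate (encode G u)) (allVecs k)           ≡⟨ map-cong (encode≡comb G) (allVecs k) ⟩
      List.map (λ u → comb (rows G) (tabulate u)) (allVecs k)      ≡⟨ map-∘ (allVecs k) ⟩
      image                                                        ∎

    unique-image : Unique image
    unique-image = Unique.map⁺ (nullity≡0⇒injective (rows G) injective _ _) (vecs-unique k)

    orthogonal⇒kernel : ∀ {k} (gs : Vec (Vec F₃ n) k) → map (Additive.comb additive-F₃ H) gs ≡ replicate k (replicate r 0₃) →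
      ∀ u → comb H (comb gs u) ≡ zeros
    orthogonal⇒kernel []       _  []      = comb-zeros H
    orthogonal⇒kernel (g ∷ gs) eq (a ∷ u) = begin
      comb H (scale a g ⊞ comb gs u)                           ≡⟨ comb-⊞ H _ _ ⟩
      comb H (scale a g) ⊞ comb H (comb gs u)                  ≡⟨ cong (_⊞ comb H (comb gs u)) (Hom.comb-homo (evaluation a) H g) ⟨
      scale a (Additive.comb additive-F₃ H g) ⊞ comb H (comb gs u)
        ≡⟨ cong₂ (λ h y → scale a h ⊞ y) (Vecₚ.∷-injectiveˡ eq) (orthogonal⇒kernel gs (Vecₚ.∷-injectiveʳ eq) u) ⟩
      scale a (replicate r 0₃) ⊞ zeros                         ≡⟨ trans (⊞-identityʳ _) (scale-zeros a r) ⟩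
      zeros                                                    ∎

    image⊆ : ∀ {e} → e ∈ image → comb H e ≡ zeros
    image⊆ e∈ with u , _ , refl ← ∈-map⁻ (comb (rows G)) e∈ = orthogonal⇒kernel (rows G) orthogonal u

-- The ternary Golay codes, their punctured codes and duals

line : ∀ {r} → Vec F₃ r → Vec (Vec F₃ 1) r
line = map (_∷ [])

-- The syndrome ω₁x + ω₂y with ω₁, ω₂ independent over 𝔽₃; a set of columns spans it exactly if it
-- spans both x and y.
plane : ∀ {r} → Vec F₃ r → Vec F₃ r → Vec (Vec F₃ 2) r
plane = zipWith λ x y → x ∷ y ∷ []

H12 : Vec (Vec F₃ 6) 12
H12 = parity G12

H11 : Vec (Vec F₃ 5) 11
H11 = parity G11

H10 : Vec (Vec F₃ 4) 10
H10 = parity G10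

H9 : Vec (Vec F₃ 3) 9
H9 = parity G9

H8 : Vec (Vec F₃ 2) 8
H8 = parity G8

-- In the modules below C is a variable, since comparing types that mention 𝒢 F G
-- at a fixed m would unfold its list of (3 ^ m) ^ 6 words.
module Golay12 {m : ℕ} (F : GF m) (C : List (Fin 12 → GF.Carrier F)) (checked : Codes.CheckedBy F H12 C) where
  open GF F
  open Codes F
  open Code H12 C checked public
  -- 792 = C(12,6) - 132: the dependent 6-sets are the supports of the words of weight 6, the hexads
  -- of S(5,6,12).
  open Covering {l = 791} refl public

  minDist : 1 ≤ m → HasMinDist C 6
  minDist 1≤m = hasMinDist 1≤m 5 refl (lookup (rows G12) zero) refl refl

  deep : 6 ≤ m → IsCode C 6 6 6 × APMCF C 6 792
  deep 6≤m = (hasDimension refl , minDist (ℕₚ.≤-trans (s≤s z≤n) 6≤m) , proj₁ apmcf) , apmcf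
    where
    apmcf : APMCF C 6 792
    -- Six independent entries: the columns of `unit` span all of 𝔽₃⁶, so no five columns of `H12`
    -- suffice.
    apmcf = apmcf-full 6≤m unit refl

golay12₁ : (F : GF 1) (C : _) → Codes.CheckedBy F H12 C → GF.IsCode F C 6 6 3 × GF.PMCF F C 3 4
golay12₁ F C checked = (hasDimension refl , minDist ℕₚ.≤-refl , proj₁ apmcf) , apmcf , 6 , minDist ℕₚ.≤-refl , ℕₚ.≤ᵇ⇒≤ 6 6 tt
  where
  open Golay12 F C checked
  apmcf : GF.APMCF F C 3 4
  -- A sum of three unit columns of `H12`; a lighter solution would differ from it by a codeword of
  -- weight below 6.
  apmcf = apmcf-checked 2 3 refl ℕₚ.≤-refl (line (1₃ ∷ 1₃ ∷ 1₃ ∷ 0₃ ∷ 0₃ ∷ 0₃ ∷ [])) refl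

module Golay11 {m : ℕ} (F : GF m) (C : List (Fin 11 → GF.Carrier F)) (checked : Codes.CheckedBy F H11 C) where
  open GF F
  open Codes F
  open Code H11 C checked public
  -- 396 = C(11,5) - 66, without the 66 blocks of S(4,5,11).
  open Covering {l = 395} refl public

  minDist : 1 ≤ m → HasMinDist C 5
  minDist 1≤m = hasMinDist 1≤m 4 refl (lookup (rows G11) (suc zero)) refl refl

  deep : 4 ≤ m → IsCode C 6 5 5 × APMCF C 5 396
  deep 4≤m = (hasDimension refl , minDist (ℕₚ.≤-trans (s≤s z≤n) 4≤m) , proj₁ apmcf) , apmcf
    where
    apmcf : APMCF C 5 396
    -- The four columns of this matrix span the hyperplane with normal (0,1,2,1,1). It contains only
    -- two columns of `H11`, so no four of them span it.
    apmcf = apmcf-full 4≤m ((2₃ ∷ 1₃ ∷ 1₃ ∷ 2₃ ∷ []) ∷ (0₃ ∷ 0₃ ∷ 2₃ ∷ 0₃ ∷ []) ∷ (2₃ ∷ 1₃ ∷ 2₃ ∷ 0₃ ∷ []) ∷ (2₃ ∷ 0₃ ∷ 0₃ ∷ 2₃ ∷ []) ∷ (0₃ ∷ 1₃ ∷ 0₃ ∷ 1₃ ∷ []) ∷ []) refl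

golay11₁ : (F : GF 1) (C : _) → Codes.CheckedBy F H11 C → GF.IsCode F C 6 5 2 × GF.PMCF F C 2 1
golay11₁ F C checked = (hasDimension refl , minDist ℕₚ.≤-refl , proj₁ apmcf) , apmcf , 5 , minDist ℕₚ.≤-refl , ℕₚ.≤ᵇ⇒≤ 4 5 tt
  where
  open Golay11 F C checked
  apmcf : GF.APMCF F C 2 1
  apmcf = apmcf-checked 1 0 refl ℕₚ.≤-refl (line (1₃ ∷ 1₃ ∷ 0₃ ∷ 0₃ ∷ 0₃ ∷ [])) refl

module Golay10 {m : ℕ} (F : GF m) (C : List (Fin 10 → GF.Carrier F)) (checked : Codes.CheckedBy F H10 C) where
  open GF F
  open Codes F
  open Code H10 C checked public
  -- 180 = C(10,4) - 30, without the 30 blocks of S(3,4,10).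
  open Covering {l = 179} refl public

  minDist : 1 ≤ m → HasMinDist C 4
  minDist 1≤m = hasMinDist 1≤m 3 refl (lookup (rows G10) (suc (suc zero))) refl refl

  deep : 3 ≤ m → IsCode C 6 4 4 × APMCF C 4 180
  deep 3≤m = (hasDimension refl , minDist (ℕₚ.≤-trans (s≤s z≤n) 3≤m) , proj₁ apmcf) , apmcf
    where
    apmcf : APMCF C 4 180
    -- The columns span the hyperplane with normal (0,1,2,1), whose only column of `H10` is the
    -- first unit vector.
    apmcf = apmcf-full 3≤m ((2₃ ∷ 0₃ ∷ 2₃ ∷ []) ∷ (2₃ ∷ 1₃ ∷ 1₃ ∷ []) ∷ (2₃ ∷ 2₃ ∷ 2₃ ∷ []) ∷ (0₃ ∷ 1₃ ∷ 1₃ ∷ []) ∷ []) refl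

golay10₁ : (F : GF 1) (C : _) → Codes.CheckedBy F H10 C → GF.IsCode F C 6 4 2 × GF.PMCF F C 2 3
golay10₁ F C checked = (hasDimension refl , minDist ℕₚ.≤-refl , proj₁ apmcf) , apmcf , 4 , minDist ℕₚ.≤-refl , ℕₚ.≤ᵇ⇒≤ 4 4 tt
  where
  open Golay10 F C checked
  apmcf : GF.APMCF F C 2 3
  apmcf = apmcf-checked 1 2 refl ℕₚ.≤-refl (line (1₃ ∷ 1₃ ∷ 0₃ ∷ 0₃ ∷ [])) refl

module Golay9 {m : ℕ} (F : GF m) (C : List (Fin 9 → GF.Carrier F)) (checked : Codes.CheckedBy F H9 C) where
  open GF F
  open Codes F
  open Code H9 C checked public
  -- 72 = C(9,3) - 12, without the 12 lines of the affine plane AG(2,3).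
  open Covering {l = 71} refl public

  minDist : 1 ≤ m → HasMinDist C 3
  minDist 1≤m = hasMinDist 1≤m 2 refl (lookup (rows G9) (suc (suc (suc zero)))) refl refl

  deep : 2 ≤ m → IsCode C 6 3 3 × APMCF C 3 72
  deep 2≤m = (hasDimension refl , minDist (ℕₚ.≤-trans (s≤s z≤n) 2≤m) , proj₁ apmcf) , apmcf
    where
    apmcf : APMCF C 3 72
    -- The hyperplane with normal (2,1,1), which contains no column of `H9`: it is the line at
    -- infinity of the affine plane formed by the columns.
    apmcf = apmcf-full 2≤m (plane (0₃ ∷ 1₃ ∷ 2₃ ∷ []) (2₃ ∷ 2₃ ∷ 0₃ ∷ [])) refl

golay9₁ : (F : GF 1) (C : _) → Codes.CheckedBy F H9 C → GF.IsCode F C 6 3 2 × GF.APMCF F C 2 9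
golay9₁ F C checked = (hasDimension refl , minDist ℕₚ.≤-refl , proj₁ apmcf) , apmcf
  where
  open Golay9 F C checked
  apmcf : GF.APMCF F C 2 9
  apmcf = apmcf-checked 1 8 refl ℕₚ.≤-refl (line (1₃ ∷ 1₃ ∷ 0₃ ∷ [])) refl

module Golay8 {m : ℕ} (F : GF m) (C : List (Fin 8 → GF.Carrier F)) (checked : Codes.CheckedBy F H8 C) where
  open GF F
  open Codes F
  open Code H8 C checked public
  -- 24 = C(8,2) - 4, without the four pairs of proportional columns.
  open Covering {l = 23} refl public

  minDist : 1 ≤ m → HasMinDist C 2
  minDist 1≤m = hasMinDist 1≤m 1 refl (lookup (rows G8) (suc (suc (suc (suc zero))))) refl refl

  deep : 2 ≤ m → IsCode C 6 2 2 × APMCF C 2 24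
  deep 2≤m = (hasDimension refl , minDist (ℕₚ.≤-trans (s≤s z≤n) 2≤m) , proj₁ apmcf) , apmcf
    where
    apmcf : APMCF C 2 24
    apmcf = apmcf-full 2≤m unit refl

golay8₁ : (F : GF 1) (C : _) → Codes.CheckedBy F H8 C → GF.IsCode F C 6 2 1 × GF.PMCF F C 1 2
golay8₁ F C checked = (hasDimension refl , minDist ℕₚ.≤-refl , proj₁ apmcf) , apmcf , 2 , minDist ℕₚ.≤-refl , ℕₚ.≤ᵇ⇒≤ 2 2 tt
  where
  open Golay8 F C checked
  apmcf : GF.APMCF F C 1 2
  apmcf = apmcf-checked 0 1 refl ℕₚ.≤-refl (line (1₃ ∷ 0₃ ∷ [])) refl

golay11₂ : (F : GF 2) (C : _) → Codes.CheckedBy F H11 C →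
  GF.IsCode F C 6 5 4 × GF.APMCF F C 4 30 × ¬ GF.UPWS F C 4
golay11₂ F C checked = (hasDimension refl , minDist (s≤s z≤n) , proj₁ apmcf) , apmcf ,
  -- The cosets in turn force β₄ = 1/30 and β₃ = 4/15, whereas the third sum then is 3 · 4/15 +
  -- 21/30 = 3/2.
  not-upws
    (profile {3} {0} {30} ℕₚ.≤-refl (plane (2₃ ∷ 1₃ ∷ 0₃ ∷ 0₃ ∷ 0₃ ∷ []) (0₃ ∷ 0₃ ∷ 2₃ ∷ 1₃ ∷ 0₃ ∷ [])) refl refl refl)
    (profile {3} {1} {22} ℕₚ.≤-refl (plane (1₃ ∷ 1₃ ∷ 0₃ ∷ 0₃ ∷ 0₃ ∷ []) (1₃ ∷ 0₃ ∷ 1₃ ∷ 0₃ ∷ 0₃ ∷ [])) refl refl refl)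
    (profile {3} {3} {21} ℕₚ.≤-refl (plane (1₃ ∷ 0₃ ∷ 0₃ ∷ 0₃ ∷ 0₃ ∷ []) (0₃ ∷ 1₃ ∷ 1₃ ∷ 0₃ ∷ 0₃ ∷ [])) refl refl refl)
    λ ()
  where
  open Golay11 F C checked
  apmcf : GF.APMCF F C 4 30
  apmcf = apmcf-checked 3 29 refl ℕₚ.≤-refl (plane (2₃ ∷ 1₃ ∷ 0₃ ∷ 0₃ ∷ 0₃ ∷ []) (0₃ ∷ 0₃ ∷ 2₃ ∷ 1₃ ∷ 0₃ ∷ [])) refl

module DualGolay10 {m : ℕ} (F : GF m) (C : List (Fin 10 → GF.Carrier F)) (checked : Codes.CheckedBy F (columns G10) C) where
  open GF F
  open Codes F
  open Code (columns G10) C checked public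
  -- Bases of the dual matroid are the complements of bases, so the count for `H10` returns;
  -- likewise for the other two duals.
  open Covering {l = 179} refl public

  minDist : 1 ≤ m → HasMinDist C 6
  -- The first row of the check matrix [-Mᵀ | I]; shortened by one and by two coordinates it serves
  -- the other duals.
  minDist 1≤m = hasMinDist 1≤m 5 refl (1₃ ∷ 1₃ ∷ 1₃ ∷ 2₃ ∷ 2₃ ∷ 0₃ ∷ 1₃ ∷ 0₃ ∷ 0₃ ∷ 0₃ ∷ []) refl refl

dualGolay10₁ : (F : GF 1) (C : _) → Codes.CheckedBy F (columns G10) C →
  GF.IsCode F C 4 6 5 × GF.APMCF F C 5 36 × ¬ GF.UPWS F C 5
dualGolay10₁ F C checked = (hasDimension refl , minDist ℕₚ.≤-refl , proj₁ apmcf) , apmcf ,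
  not-upws
    (profile {4} {0} {36} ℕₚ.≤-refl (line (0₃ ∷ 1₃ ∷ 1₃ ∷ 1₃ ∷ 1₃ ∷ 1₃ ∷ [])) refl refl refl)
    (profile {4} {15} {0} ℕₚ.≤-refl (line (1₃ ∷ 2₃ ∷ 1₃ ∷ 1₃ ∷ 0₃ ∷ 0₃ ∷ [])) refl refl refl)
    (profile {4} {9} {9} ℕₚ.≤-refl (line (2₃ ∷ 1₃ ∷ 1₃ ∷ 0₃ ∷ 1₃ ∷ 0₃ ∷ [])) refl refl refl)
    λ ()
  where
  open DualGolay10 F C checked
  apmcf : GF.APMCF F C 5 36
  apmcf = apmcf-checked 4 35 refl ℕₚ.≤-refl (line (0₃ ∷ 1₃ ∷ 1₃ ∷ 1₃ ∷ 1₃ ∷ 1₃ ∷ [])) refl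

dualGolay10₂ : (F : GF 2) (C : _) → Codes.CheckedBy F (columns G10) C →
  GF.IsCode F C 4 6 6 × GF.APMCF F C 6 180 × ¬ GF.UPWS F C 6
dualGolay10₂ F C checked = (hasDimension refl , minDist (s≤s z≤n) , proj₁ apmcf) , apmcf ,
  not-upws
    (profile {5} {0} {180} ℕₚ.≤-refl (plane (0₃ ∷ 1₃ ∷ 1₃ ∷ 1₃ ∷ 1₃ ∷ 1₃ ∷ []) (1₃ ∷ 0₃ ∷ 2₃ ∷ 2₃ ∷ 1₃ ∷ 1₃ ∷ [])) refl refl refl)
    -- The farthest-off coset of the code over 𝔽₃, now at distance R - 1; its 36 nearest codewords
    -- persist under lifting. The second profiles of the other two duals over 𝔽₉ arise in the same
    -- way.
    (profile {5} {36} {0} (s≤s z≤n) (line (0₃ ∷ 1₃ ∷ 1₃ ∷ 1₃ ∷ 1₃ ∷ 1₃ ∷ [])) refl refl refl)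
    (profile {5} {18} {117} ℕₚ.≤-refl (plane (1₃ ∷ 2₃ ∷ 0₃ ∷ 2₃ ∷ 1₃ ∷ 0₃ ∷ []) (1₃ ∷ 0₃ ∷ 0₃ ∷ 1₃ ∷ 0₃ ∷ 1₃ ∷ [])) refl refl refl)
    λ ()
  where
  open DualGolay10 F C checked
  apmcf : GF.APMCF F C 6 180
  apmcf = apmcf-full ℕₚ.≤-refl (plane (0₃ ∷ 1₃ ∷ 1₃ ∷ 1₃ ∷ 1₃ ∷ 1₃ ∷ []) (1₃ ∷ 0₃ ∷ 2₃ ∷ 2₃ ∷ 1₃ ∷ 1₃ ∷ [])) refl

module DualGolay9 {m : ℕ} (F : GF m) (C : List (Fin 9 → GF.Carrier F)) (checked : Codes.CheckedBy F (columns G9) C) where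
  open GF F
  open Codes F
  open Code (columns G9) C checked public
  open Covering {l = 71} refl public

  minDist : 1 ≤ m → HasMinDist C 6
  minDist 1≤m = hasMinDist 1≤m 5 refl (1₃ ∷ 1₃ ∷ 1₃ ∷ 2₃ ∷ 2₃ ∷ 0₃ ∷ 1₃ ∷ 0₃ ∷ 0₃ ∷ []) refl refl

dualGolay9₁ : (F : GF 1) (C : _) → Codes.CheckedBy F (columns G9) C →
  GF.IsCode F C 3 6 5 × GF.APMCF F C 5 18 × ¬ GF.UPWS F C 5
dualGolay9₁ F C checked = (hasDimension refl , minDist ℕₚ.≤-refl , proj₁ apmcf) , apmcf ,
  not-upws
    (profile {4} {0} {18} ℕₚ.≤-refl (line (0₃ ∷ 1₃ ∷ 1₃ ∷ 1₃ ∷ 1₃ ∷ 1₃ ∷ [])) refl refl refl)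
    (profile {4} {9} {0} ℕₚ.≤-refl (line (1₃ ∷ 2₃ ∷ 1₃ ∷ 1₃ ∷ 0₃ ∷ 0₃ ∷ [])) refl refl refl)
    (profile {4} {5} {5} ℕₚ.≤-refl (line (2₃ ∷ 1₃ ∷ 1₃ ∷ 1₃ ∷ 0₃ ∷ 0₃ ∷ [])) refl refl refl)
    λ ()
  where
  open DualGolay9 F C checked
  apmcf : GF.APMCF F C 5 18
  apmcf = apmcf-checked 4 17 refl ℕₚ.≤-refl (line (0₃ ∷ 1₃ ∷ 1₃ ∷ 1₃ ∷ 1₃ ∷ 1₃ ∷ [])) refl

dualGolay9₂ : (F : GF 2) (C : _) → Codes.CheckedBy F (columns G9) C →
  GF.IsCode F C 3 6 6 × GF.APMCF F C 6 72 × ¬ GF.UPWS F C 6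
dualGolay9₂ F C checked = (hasDimension refl , minDist (s≤s z≤n) , proj₁ apmcf) , apmcf ,
  not-upws
    (profile {5} {0} {72} ℕₚ.≤-refl (plane (0₃ ∷ 1₃ ∷ 1₃ ∷ 1₃ ∷ 1₃ ∷ 1₃ ∷ []) (1₃ ∷ 0₃ ∷ 1₃ ∷ 2₃ ∷ 0₃ ∷ 2₃ ∷ [])) refl refl refl)
    (profile {5} {18} {0} (s≤s z≤n) (line (0₃ ∷ 1₃ ∷ 1₃ ∷ 1₃ ∷ 1₃ ∷ 1₃ ∷ [])) refl refl refl)
    (profile {5} {8} {49} ℕₚ.≤-refl (plane (1₃ ∷ 2₃ ∷ 0₃ ∷ 2₃ ∷ 1₃ ∷ 0₃ ∷ []) (1₃ ∷ 0₃ ∷ 0₃ ∷ 1₃ ∷ 0₃ ∷ 1₃ ∷ [])) refl refl refl)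
    λ ()
  where
  open DualGolay9 F C checked
  apmcf : GF.APMCF F C 6 72
  apmcf = apmcf-full ℕₚ.≤-refl (plane (0₃ ∷ 1₃ ∷ 1₃ ∷ 1₃ ∷ 1₃ ∷ 1₃ ∷ []) (1₃ ∷ 0₃ ∷ 1₃ ∷ 2₃ ∷ 0₃ ∷ 2₃ ∷ [])) refl

module DualGolay8 {m : ℕ} (F : GF m) (C : List (Fin 8 → GF.Carrier F)) (checked : Codes.CheckedBy F (columns G8) C) where
  open GF F
  open Codes F
  open Code (columns G8) C checked public
  open Covering {l = 23} refl public

  minDist : 1 ≤ m → HasMinDist C 6
  minDist 1≤m = hasMinDist 1≤m 5 refl (1₃ ∷ 1₃ ∷ 1₃ ∷ 2₃ ∷ 2₃ ∷ 0₃ ∷ 1₃ ∷ 0₃ ∷ []) refl refl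

dualGolay8₁ : (F : GF 1) (C : _) → Codes.CheckedBy F (columns G8) C →
  GF.IsCode F C 2 6 5 × GF.APMCF F C 5 8 × ¬ GF.UPWS F C 5
dualGolay8₁ F C checked = (hasDimension refl , minDist ℕₚ.≤-refl , proj₁ apmcf) , apmcf ,
  not-upws
    (profile {4} {0} {8} ℕₚ.≤-refl (line (1₃ ∷ 0₃ ∷ 1₃ ∷ 1₃ ∷ 1₃ ∷ 1₃ ∷ [])) refl refl refl)
    (profile {4} {5} {0} ℕₚ.≤-refl (line (2₃ ∷ 1₃ ∷ 1₃ ∷ 1₃ ∷ 0₃ ∷ 0₃ ∷ [])) refl refl refl)
    (profile {4} {2} {3} ℕₚ.≤-refl (line (1₃ ∷ 0₃ ∷ 1₃ ∷ 0₃ ∷ 1₃ ∷ 1₃ ∷ [])) refl refl refl)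
    λ ()
  where
  open DualGolay8 F C checked
  apmcf : GF.APMCF F C 5 8
  apmcf = apmcf-checked 4 7 refl ℕₚ.≤-refl (line (1₃ ∷ 0₃ ∷ 1₃ ∷ 1₃ ∷ 1₃ ∷ 1₃ ∷ [])) refl

dualGolay8₂ : (F : GF 2) (C : _) → Codes.CheckedBy F (columns G8) C →
  GF.IsCode F C 2 6 6 × GF.APMCF F C 6 24 × ¬ GF.UPWS F C 6
dualGolay8₂ F C checked = (hasDimension refl , minDist (s≤s z≤n) , proj₁ apmcf) , apmcf ,
  not-upws
    (profile {5} {0} {24} ℕₚ.≤-refl (plane (1₃ ∷ 2₃ ∷ 0₃ ∷ 2₃ ∷ 1₃ ∷ 0₃ ∷ []) (0₃ ∷ 1₃ ∷ 2₃ ∷ 2₃ ∷ 0₃ ∷ 1₃ ∷ [])) refl refl refl)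
    (profile {5} {8} {0} (s≤s z≤n) (line (1₃ ∷ 0₃ ∷ 1₃ ∷ 1₃ ∷ 1₃ ∷ 1₃ ∷ [])) refl refl refl)
    (profile {5} {6} {15} ℕₚ.≤-refl (plane (0₃ ∷ 2₃ ∷ 1₃ ∷ 1₃ ∷ 0₃ ∷ 0₃ ∷ []) (1₃ ∷ 2₃ ∷ 0₃ ∷ 0₃ ∷ 1₃ ∷ 0₃ ∷ [])) refl refl refl)
    λ ()
  where
  open DualGolay8 F C checked
  apmcf : GF.APMCF F C 6 24
  apmcf = apmcf-full ℕₚ.≤-refl (plane (1₃ ∷ 2₃ ∷ 0₃ ∷ 2₃ ∷ 1₃ ∷ 0₃ ∷ []) (0₃ ∷ 1₃ ∷ 2₃ ∷ 2₃ ∷ 0₃ ∷ 1₃ ∷ [])) refl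

-- Application to `𝒢` and `𝒢⊥`

checked12 : ∀ {m} (F : GF m) → Codes.CheckedBy F H12 (𝒢 F G12)
checked12 F = Codes.lifted-checked F G12 H12 refl refl refl

golay12 : ∀ {m} (F : GF m) → 6 ≤ m → GF.IsCode F (𝒢 F G12) 6 6 6 × GF.APMCF F (𝒢 F G12) 6 792
golay12 F 6≤m = Golay12.deep F (𝒢 F G12) (checked12 F) 6≤m

checked11 : ∀ {m} (F : GF m) → Codes.CheckedBy F H11 (𝒢 F G11)
checked11 F = Codes.lifted-checked F G11 H11 refl refl refl

golay11 : ∀ {m} (F : GF m) → 4 ≤ m → GF.IsCode F (𝒢 F G11) 6 5 5 × GF.APMCF F (𝒢 F G11) 5 396
golay11 F 4≤m = Golay11.deep F (𝒢 F G11) (checked11 F) 4≤m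

checked10 : ∀ {m} (F : GF m) → Codes.CheckedBy F H10 (𝒢 F G10)
checked10 F = Codes.lifted-checked F G10 H10 refl refl refl

golay10 : ∀ {m} (F : GF m) → 3 ≤ m → GF.IsCode F (𝒢 F G10) 6 4 4 × GF.APMCF F (𝒢 F G10) 4 180
golay10 F 3≤m = Golay10.deep F (𝒢 F G10) (checked10 F) 3≤m

checked9 : ∀ {m} (F : GF m) → Codes.CheckedBy F H9 (𝒢 F G9)
checked9 F = Codes.lifted-checked F G9 H9 refl refl refl

golay9 : ∀ {m} (F : GF m) → 2 ≤ m → GF.IsCode F (𝒢 F G9) 6 3 3 × GF.APMCF F (𝒢 F G9) 3 72
golay9 F 2≤m = Golay9.deep F (𝒢 F G9) (checked9 F) 2≤m

checked8 : ∀ {m} (F : GF m) → Codes.CheckedBy F H8 (𝒢 F G8)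
checked8 F = Codes.lifted-checked F G8 H8 refl refl refl

golay8 : ∀ {m} (F : GF m) → 2 ≤ m → GF.IsCode F (𝒢 F G8) 6 2 2 × GF.APMCF F (𝒢 F G8) 2 24
golay8 F 2≤m = Golay8.deep F (𝒢 F G8) (checked8 F) 2≤m

dualChecked10 : ∀ {m} (F : GF m) → Codes.CheckedBy F (columns G10) (𝒢⊥ F G10)
dualChecked10 F = Codes.liftedDual-checked F G10

dualChecked9 : ∀ {m} (F : GF m) → Codes.CheckedBy F (columns G9) (𝒢⊥ F G9)
dualChecked9 F = Codes.liftedDual-checked F G9

dualChecked8 : ∀ {m} (F : GF m) → Codes.CheckedBy F (columns G8) (𝒢⊥ F G8)
dualChecked8 F = Codes.liftedDual-checked F G8

theorem5p4 : ((F : GF 1) → GF.IsCode F (𝒢 F G12) 6 6 3 × GF.PMCF F (𝒢 F G12) 3 4) ×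
    ((m : ℕ) → 6 ≤ m → (F : GF m) →
    GF.IsCode F (𝒢 F G12) 6 6 6 × Σ ℕ (λ l → GF.APMCF F (𝒢 F G12) 6 l)) ×
    ((F : GF 1) → GF.IsCode F (𝒢 F G11) 6 5 2 × GF.PMCF F (𝒢 F G11) 2 1) ×
    ((m : ℕ) → 4 ≤ m → (F : GF m) →
    GF.IsCode F (𝒢 F G11) 6 5 5 × Σ ℕ (λ l → GF.APMCF F (𝒢 F G11) 5 l)) ×
    ((F : GF 1) → GF.IsCode F (𝒢 F G10) 6 4 2 × GF.PMCF F (𝒢 F G10) 2 3) ×
    ((m : ℕ) → 3 ≤ m → (F : GF m) →
    GF.IsCode F (𝒢 F G10) 6 4 4 × Σ ℕ (λ l → GF.APMCF F (𝒢 F G10) 4 l)) ×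
    ((F : GF 3) → GF.APMCF F (𝒢 F G10) 4 180) ×
    ((F : GF 1) → GF.IsCode F (𝒢 F G9) 6 3 2 × GF.APMCF F (𝒢 F G9) 2 9) ×
    ((m : ℕ) → 2 ≤ m → (F : GF m) →
    GF.IsCode F (𝒢 F G9) 6 3 3 × Σ ℕ (λ l → GF.APMCF F (𝒢 F G9) 3 l)) ×
    ((F : GF 2) → GF.APMCF F (𝒢 F G9) 3 72) ×
    ((F : GF 3) → GF.APMCF F (𝒢 F G9) 3 72) ×
    ((F : GF 1) → GF.IsCode F (𝒢 F G8) 6 2 1 × GF.PMCF F (𝒢 F G8) 1 2) ×
    ((m : ℕ) → 2 ≤ m → (F : GF m) →
    GF.IsCode F (𝒢 F G8) 6 2 2 × Σ ℕ (λ l → GF.APMCF F (𝒢 F G8) 2 l)) ×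
    ((F : GF 2) → GF.APMCF F (𝒢 F G8) 2 24) ×
    ((F : GF 3) → GF.APMCF F (𝒢 F G8) 2 24) ×
    ((F : GF 2) → GF.IsCode F (𝒢 F G11) 6 5 4 × GF.APMCF F (𝒢 F G11) 4 30 × ¬ GF.UPWS F (𝒢 F G11) 4) ×
    ((F : GF 1) → GF.IsCode F (𝒢⊥ F G10) 4 6 5 × GF.APMCF F (𝒢⊥ F G10) 5 36 × ¬ GF.UPWS F (𝒢⊥ F G10) 5) ×
    ((F : GF 2) → GF.IsCode F (𝒢⊥ F G10) 4 6 6 × GF.APMCF F (𝒢⊥ F G10) 6 180 × ¬ GF.UPWS F (𝒢⊥ F G10) 6) ×
    ((F : GF 1) → GF.IsCode F (𝒢⊥ F G9) 3 6 5 × GF.APMCF F (𝒢⊥ F G9) 5 18 × ¬ GF.UPWS F (𝒢⊥ F G9) 5) ×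
    ((F : GF 2) → GF.IsCode F (𝒢⊥ F G9) 3 6 6 × GF.APMCF F (𝒢⊥ F G9) 6 72 × ¬ GF.UPWS F (𝒢⊥ F G9) 6) ×
    ((F : GF 1) → GF.IsCode F (𝒢⊥ F G8) 2 6 5 × GF.APMCF F (𝒢⊥ F G8) 5 8 × ¬ GF.UPWS F (𝒢⊥ F G8) 5) ×
    ((F : GF 2) → GF.IsCode F (𝒢⊥ F G8) 2 6 6 × GF.APMCF F (𝒢⊥ F G8) 6 24 × ¬ GF.UPWS F (𝒢⊥ F G8) 6)
theorem5p4 =
  (λ F → golay12₁ F (𝒢 F G12) (checked12 F)) ,
  (λ m 6≤m F → let isCode , apmcf = golay12 F 6≤m in isCode , 792 , apmcf) ,
  (λ F → golay11₁ F (𝒢 F G11) (checked11 F)) ,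
  (λ m 4≤m F → let isCode , apmcf = golay11 F 4≤m in isCode , 396 , apmcf) ,
  (λ F → golay10₁ F (𝒢 F G10) (checked10 F)) ,
  (λ m 3≤m F → let isCode , apmcf = golay10 F 3≤m in isCode , 180 , apmcf) ,
  (λ F → proj₂ (golay10 F ℕₚ.≤-refl)) ,
  (λ F → golay9₁ F (𝒢 F G9) (checked9 F)) ,
  (λ m 2≤m F → let isCode , apmcf = golay9 F 2≤m in isCode , 72 , apmcf) ,
  (λ F → proj₂ (golay9 F ℕₚ.≤-refl)) ,
  (λ F → proj₂ (golay9 F (s≤s (s≤s z≤n)))) ,
  (λ F → golay8₁ F (𝒢 F G8) (checked8 F)) ,
  (λ m 2≤m F → let isCode , apmcf = golay8 F 2≤m in isCode , 24 , apmcf) ,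
  (λ F → proj₂ (golay8 F ℕₚ.≤-refl)) ,
  (λ F → proj₂ (golay8 F (s≤s (s≤s z≤n)))) ,
  (λ F → golay11₂ F (𝒢 F G11) (checked11 F)) ,
  (λ F → dualGolay10₁ F (𝒢⊥ F G10) (dualChecked10 F)) ,
  (λ F → dualGolay10₂ F (𝒢⊥ F G10) (dualChecked10 F)) ,
  (λ F → dualGolay9₁ F (𝒢⊥ F G9) (dualChecked9 F)) ,
  (λ F → dualGolay9₂ F (𝒢⊥ F G9) (dualChecked9 F)) ,
  (λ F → dualGolay8₁ F (𝒢⊥ F G8) (dualChecked8 F)) ,
  (λ F → dualGolay8₂ F (𝒢⊥ F G8) (dualChecked8 F))
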